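{- $\overline{\theta}(K_{15}) = 4$, where $K_{15}$ is the complete graph on 15 vertices.
   Context: The geometric thickness $\overline{\theta}(G)$ of a graph $G$ is the smallest integer $k$ such that the vertices of $G$ can be placed at distinct points of the plane, each edge drawn as the straight line segment joining its endpoints, and each edge assigned to one of $k$ layers so that no two edges assigned to the same layer cross (i.e. two edges on the same layer meet at most in a common endpoint).
   Formalization: The vertices of the graph are placed at distinct points of the plane with rational coordinates, instead of arbitrary real points; the claim that fewer than 4 layers do not suffice is thus stated for rational placements only. -}

module Defs where

open import Data.Nat using (ℕ; _<_)
open import Data.Fin using (Fin) renaming (_<_ to _<ᶠ_)
open import Data.Rational using (ℚ; 0ℚ; 1ℚ; _+_; _*_; _-_; _≤_)
open import Data.Product using (_×_; _,_; Σ; proj₁; proj₂)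
open import Data.Sum using (_⊎_)
open import Relation.Binary.PropositionalEquality using (_≡_)
open import Relation.Nullary using (¬_)
open import Function.Definitions using (Injective)

Point : Set
Point = ℚ × ℚ

OnSegment : Point → Point → Point → Set
OnSegment (ax , ay) (bx , by) (px , py) =
  Σ ℚ λ t → (0ℚ ≤ t) × (t ≤ 1ℚ)
          × (px ≡ ax + t * (bx - ax)) × (py ≡ ay + t * (by - ay))

NonCrossing : Point → Point → Point → Point → Set
NonCrossing a b c d =
  ∀ p → OnSegment a b p → OnSegment c d p →
    ((p ≡ a) ⊎ (p ≡ b)) × ((p ≡ c) ⊎ (p ≡ d))

-- The complete graph K_n: vertices Fin n, edges {i , j} with i < j
-- (each edge represented once as an ordered pair with i < j).

record GeometricDrawingKn (n k : ℕ) : Set where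
  field
    pos       : Fin n → Point
    pos-inj   : Injective _≡_ _≡_ pos
    layer     : (i j : Fin n) → i <ᶠ j → Fin k
    noCross   : ∀ (i j i' j' : Fin n) (ij : i <ᶠ j) (ij' : i' <ᶠ j') →
                ¬ ((i ≡ i') × (j ≡ j')) →
                layer i j ij ≡ layer i' j' ij' →
                NonCrossing (pos i) (pos j) (pos i') (pos j')

GeometricThicknessKnIs : ℕ → ℕ → Set
GeometricThicknessKnIs n t =
  GeometricDrawingKn n t × (∀ k → k < t → ¬ GeometricDrawingKn n k)

{-# OPTIONS --safe #-}

-- A plane straight-line graph on n points in general position has at most 3n - 3 - h edges if it
-- contains the h edges of the convex hull: every edge is charged to the point at its left end if it is the
-- steepest edge leaving that point to the right, to the point at its right end if it is the topmost edge arriving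
-- there, and otherwise to a point that lies just above it; hull points and the two extreme points waste slots.
--
-- Suppose three layers suffice for K₁₅. Perturb the points into general position and add to every layer all
-- edges that no edge of K₁₅ crosses. With |U| such edges this gives 105 + 2|U| ≤ 3 (42 - h), i.e. 2|U| + 3h ≤ 21,
-- so h ≤ 4. If h = 4, a line through two opposite hull points has two points on one side, and the two points
-- farthest from it span a fifth uncrossed edge. If h = 3, each corner c of the hull spans an uncrossed edge with the
-- point q nearest to it, so |U| ≥ 6 and the bound is attained; but with r the next point after q, one of c r and q r
-- can still be added to the layer that contains neither.
module Submission where

open import Defs
open import Data.Nat as ℕ using (ℕ; zero; suc)
import Data.Nat.Properties as ℕ
import Data.Nat.Solver as ℕ
open import Data.Integer as ℤ using (ℤ; +_)
open import Data.Rational as ℚ using (ℚ; 0ℚ; 1ℚ; _+_; _*_; _-_; -_; _≤_; _<_; _⊓_; 1/_; _/_; positive; nonNegative; NonZero)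
import Data.Rational.Properties as ℚ
open import Data.Rational.Solver using (module +-*-Solver)
open import Data.Fin as Fin using (Fin; zero; suc; inject≤)
open import Data.Fin.Patterns using (0F; 1F; 2F; 3F)
import Data.Fin.Properties as Fin
open import Data.Fin.Induction using (spo-noetherian)
open import Data.Vec as Vec using (Vec; []; _∷_)
open import Data.List using (List; []; _∷_; _++_; length; lookup; map; filter; allFin; cartesianProduct)
open import Data.List.Properties using (length-++; length-map)
open import Data.List.Membership.Propositional using (_∈_; _∉_)
open import Data.List.Membership.Propositional.Properties
  using (∈-lookup; ∈-map⁺; ∈-map⁻; ∈-++⁺ˡ; ∈-++⁺ʳ; ∈-++⁻; ∈-filter⁺; ∈-cartesianProduct⁺; ∈-allFin)
open import Data.List.Relation.Unary.All as All using (All; []; _∷_)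
import Data.List.Relation.Unary.All.Properties as All
open import Data.List.Relation.Unary.AllPairs using ([]; _∷_)
open import Data.List.Relation.Unary.Any as Any using (here; there)
open import Data.List.Relation.Unary.Any.Properties using (lookup-index)
open import Data.List.Relation.Unary.Unique.Propositional using (Unique)
import Data.List.Relation.Unary.Unique.Propositional.Properties as Unique
open import Data.Product as Product using (_×_; _,_; ∃; proj₁; proj₂)
open import Data.Product.Function.NonDependent.Propositional using (_×-↔_)
open import Data.Product.Properties using (≡-dec)
open import Data.Sum as Sum using (_⊎_; inj₁; inj₂; [_,_]′)
open import Data.Sum.Function.Propositional using (_⊎-↔_)
open import Data.Empty using (⊥; ⊥-elim)
open import Data.Unit using (⊤; tt)
open import Function using (_∘_; flip; case_of_; _↔_; Inverse)
open import Function.Construct.Composition using (_↔-∘_)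
open import Function.Construct.Identity using (↔-id)
open import Induction.WellFounded using (Acc; acc)
open import Level using (0ℓ)
open import Relation.Binary as Binary using (Rel; IsStrictTotalOrder; Tri; tri<; tri≈; tri>)
open import Relation.Binary.PropositionalEquality
open import Relation.Nullary using (¬_; Dec; yes; no; contradiction)
open import Relation.Nullary.Decidable using (_×-dec_; _⊎-dec_; _→-dec_; ¬?; toWitness)
open import Relation.Unary using (Pred; Decidable)
-- Order types and the edge bound

-- The edge bound usually comes from Euler's formula; charging obtains it from orientations of
-- triples alone, without faces or continuity. Hull edges are uncrossed, so |U| ≥ h turns the
-- inequality into 5h ≤ 21. For h = 4 a fifth uncrossed edge gives 10 + 12 = 22. For h = 3 the count
-- is 12 + 9 = 21, so a single further edge in a single layer is decisive. That edge is found as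
-- follows. The line through r parallel to the side opposite c cuts off only c and q. Hence an edge
-- that crosses c r, with four different ends, must end at q, and one that crosses q r must end at
-- c. If q y blocked c r and c z blocked q r, both in the layer in question, then q y and c z would
-- cross each other in that layer. The perturbation is harmless because edges of one layer with four
-- different ends are disjoint closed segments, and disjointness survives small motions even when
-- ends are collinear.

fresh : ∀ {n} (xs : List (Fin n)) → length xs ℕ.< n → ∃ λ z → z ∉ xs
fresh {n} xs xs<n = Fin.¬∀⟶∃¬ n (_∈ xs) (λ z → Any.any? (z Fin.≟_) xs) λ all →
  ℕ.<⇒≱ xs<n (Fin.injective⇒≤ {f = λ z → Any.index (all z)} λ {z} {w} eq →
    trans (lookup-index (all z)) (trans (cong (lookup xs) eq) (sym (lookup-index (all w)))))

module _ {A : Set} {_⊏_ : Rel A 0ℓ} {P : Pred A 0ℓ} (_⊏?_ : Binary.Decidable _⊏_)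
         (irrefl : ∀ {x} → ¬ x ⊏ x)
         (tr : ∀ {x y z} → P x → P y → P z → x ⊏ y → y ⊏ z → x ⊏ z) where

  -- Transitivity is asked only within `P`, because slopes around a point compare transitively only
  -- among points on one side of it.
  minimalOf : ∀ m xs → P m → All P xs →
              ∃ λ m′ → P m′ × (m′ ≡ m ⊎ m′ ⊏ m) × ¬ m ⊏ m′ × All (λ x → ¬ x ⊏ m′) xs
  minimalOf m [] pm [] = m , pm , inj₁ refl , irrefl , []
  minimalOf m (x ∷ xs) pm (px ∷ pxs) with x ⊏? m
  ... | yes x⊏m with minimalOf x xs px pxs
  ...   | m′ , pm′ , inj₁ refl , x⊀m′ , min =
    m′ , pm′ , inj₂ x⊏m , (λ m⊏m′ → irrefl (tr pm pm′ pm m⊏m′ x⊏m)) , x⊀m′ ∷ min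
  ...   | m′ , pm′ , inj₂ m′⊏x , x⊀m′ , min =
    let m′⊏m = tr pm′ px pm m′⊏x x⊏m in
    m′ , pm′ , inj₂ m′⊏m , (λ m⊏m′ → irrefl (tr pm pm′ pm m⊏m′ m′⊏m)) , x⊀m′ ∷ min
  minimalOf m (x ∷ xs) pm (px ∷ pxs) | no x⊀m with minimalOf m xs pm pxs
  ... | m′ , pm′ , m′≤m , m⊀m′ , min =
    m′ , pm′ , m′≤m , m⊀m′ ,
    (λ x⊏m′ → x⊀m ([ (λ { refl → x⊏m′ }) , tr px pm′ pm x⊏m′ ]′ m′≤m)) ∷ min

minimal : ∀ {n} {_⊏_ : Rel (Fin n) 0ℓ} {P : Pred (Fin n) 0ℓ} → Binary.Decidable _⊏_ → Decidable P →
          (∀ {x} → ¬ x ⊏ x) → (∀ {x y z} → P x → P y → P z → x ⊏ y → y ⊏ z → x ⊏ z) →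
          ∃ P → ∃ λ m → P m × (∀ x → P x → ¬ x ⊏ m)
minimal {n} _⊏?_ P? irrefl tr (m , pm)
  with minimalOf _⊏?_ irrefl tr m (filter P? (allFin n)) pm (All.all-filter P? (allFin n))
... | m′ , pm′ , _ , _ , min = m′ , pm′ , λ x px → All.lookup min (∈-filter⁺ P? (∈-allFin x) px)

lookup-injective : ∀ {A : Set} {xs : List A} → Unique xs → ∀ {i j} → lookup xs i ≡ lookup xs j → i ≡ j
lookup-injective (_ ∷ _)  {zero}  {zero}  _  = refl
lookup-injective (x ∷ _)  {zero}  {suc j} eq = contradiction eq (All.lookup x (∈-lookup j))
lookup-injective (x ∷ _)  {suc i} {zero}  eq = contradiction (sym eq) (All.lookup x (∈-lookup i))
lookup-injective (_ ∷ xs) {suc i} {suc j} eq = cong suc (lookup-injective xs eq)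

-- Pigeonhole for a relation: `total` picks a partner for each element and `unique` makes the choice
-- injective. A relation allows the charging rules to be given as clauses on an item and a slot.
card-≤ : ∀ {A B : Set} {m n} → Fin m ↔ A → Fin n ↔ B → (R : A → B → Set) →
         (∀ a → ∃ (R a)) → (∀ {a a′ b} → R a b → R a′ b → a ≡ a′) → m ℕ.≤ n
card-≤ f g R total unique = Fin.injective⇒≤ {f = λ i → G.from (proj₁ (total (F.to i)))} λ {i} {j} eq →
  let b≡b′ = trans (sym (G.inverseˡ refl)) (trans (cong G.to eq) (G.inverseˡ refl)) in
  trans (sym (F.inverseʳ refl))
    (trans (cong F.from (unique (proj₂ (total (F.to i))) (subst (R (F.to j)) (sym b≡b′) (proj₂ (total (F.to j))))))
           (F.inverseʳ refl))
  where module F = Inverse f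
        module G = Inverse g

-- An abstract order type together with the left-to-right order of the points. For a ≺ b,
-- `Ccw a b c` reads "c is above the line a b". Working from axioms lets one argument serve for both
-- upper and lower sides, through `mirror`.
record OrderType (n : ℕ) : Set₁ where
  field
    _≺_ : Rel (Fin n) 0ℓ
    isStrictTotalOrder : IsStrictTotalOrder _≡_ _≺_
    Ccw : (a b c : Fin n) → Set
    ccw-total : ∀ {a b c} → a ≢ b → b ≢ c → a ≢ c → Ccw a b c ⊎ Ccw b a c
    ccw-asym  : ∀ {a b c} → Ccw a b c → ¬ Ccw b a c
    ccw-cyc   : ∀ {a b c} → Ccw a b c → Ccw b c a
    -- Around p, Ccw p compares slopes; the axioms say that it is transitive also across the vertical line at p.
    right-trans  : ∀ {p u v w} → p ≺ u → p ≺ v → p ≺ w → Ccw p u v → Ccw p v w → Ccw p u w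
    left-trans   : ∀ {p u v w} → u ≺ p → v ≺ p → w ≺ p → Ccw p u v → Ccw p v w → Ccw p u w
    across-right : ∀ {p u v w} → u ≺ p → p ≺ v → p ≺ w → Ccw p v w → Ccw p v u → Ccw p w u
    across-left  : ∀ {p u v w} → u ≺ p → v ≺ p → p ≺ w → Ccw p u v → Ccw p u w → Ccw p v w

  open IsStrictTotalOrder isStrictTotalOrder public
    using (compare; isStrictPartialOrder) renaming (_<?_ to _≺?_; trans to ≺-trans; irrefl to ≺-irrefl; asym to ≺-asym)

  ≺⇒≢ : ∀ {a b} → a ≺ b → a ≢ b
  ≺⇒≢ a≺b refl = ≺-irrefl refl a≺b

  ccw-≢ : ∀ {a b c} → Ccw a b c → a ≢ b
  ccw-≢ abc refl = ccw-asym abc abc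

  ccw? : ∀ a b c → Dec (Ccw a b c)
  ccw? a b c with a Fin.≟ b | b Fin.≟ c | a Fin.≟ c
  ... | yes a≡b | _       | _       = no λ abc → ccw-≢ abc a≡b
  ... | no _    | yes b≡c | _       = no λ abc → ccw-≢ (ccw-cyc abc) b≡c
  ... | no _    | no _    | yes a≡c = no λ abc → ccw-≢ (ccw-cyc (ccw-cyc abc)) (sym a≡c)
  ... | no a≢b  | no b≢c  | no a≢c with ccw-total a≢b b≢c a≢c
  ...   | inj₁ abc = yes abc
  ...   | inj₂ bac = no λ abc → ccw-asym abc bac

  ccw-swap : ∀ {a b c} → Ccw a b c → ¬ Ccw a c b
  ccw-swap abc acb = ccw-asym abc (ccw-cyc (ccw-cyc acb))

  -- A proper crossing in which c is to the left of the directed line a b and d to the right. The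
  -- crossing with these sides exchanged is `Crossing b a c d`, so `planar` excludes both.
  Crossing : (a b c d : Fin n) → Set
  Crossing a b c d = Ccw a b c × Ccw b a d × Ccw c d b × Ccw d c a

  UpperHull LowerHull : (p q : Fin n) → Set
  UpperHull p q = p ≺ q × (∀ w → w ≢ p → w ≢ q → Ccw q p w)
  LowerHull p q = p ≺ q × (∀ w → w ≢ p → w ≢ q → Ccw p q w)

  record Plane (E : Rel (Fin n) 0ℓ) : Set where
    field
      ordered : ∀ {a b} → E a b → a ≺ b
      planar  : ∀ {a b c d} → E a b → E c d → ¬ Crossing a b c d × ¬ Crossing b a c d

module _ {n} (O : OrderType n) where
  open OrderType O

  -- Reflection in a horizontal axis: above and below are exchanged, left and right stay.
  mirror : OrderType n
  mirror = record
    { _≺_ = _≺_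
    ; isStrictTotalOrder = isStrictTotalOrder
    ; Ccw = λ a b c → Ccw b a c
    ; ccw-total = λ a≢b b≢c a≢c → ccw-total (a≢b ∘ sym) a≢c b≢c
    ; ccw-asym = ccw-asym
    ; ccw-cyc = ccw-cyc ∘ ccw-cyc
    ; right-trans = λ p≺u p≺v p≺w upv vpw →
        ccw-cyc (ccw-cyc (right-trans p≺w p≺v p≺u (ccw-cyc vpw) (ccw-cyc upv)))
    ; left-trans = λ u≺p v≺p w≺p upv vpw →
        ccw-cyc (ccw-cyc (left-trans w≺p v≺p u≺p (ccw-cyc vpw) (ccw-cyc upv)))
    -- By totality it is enough to refute the unreflected orientation, from which the original axiom
    -- derives a contradiction.
    ; across-right = λ u≺p p≺v p≺w vpw vpu →
        [ ccw-asym-elim vpu ∘ across-right u≺p p≺w p≺v (ccw-cyc vpw)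
        , (λ wpu → wpu) ]′
        (ccw-total (≺⇒≢ p≺w) (≺⇒≢ (≺-trans u≺p p≺w) ∘ sym) (≺⇒≢ u≺p ∘ sym))
    ; across-left = λ u≺p v≺p p≺w upv upw →
        [ ccw-asym-elim upw ∘ across-left v≺p u≺p p≺w (ccw-cyc upv)
        , (λ vpw → vpw) ]′
        (ccw-total (≺⇒≢ v≺p ∘ sym) (≺⇒≢ (≺-trans v≺p p≺w)) (≺⇒≢ p≺w))
    }
    where
    ccw-asym-elim : ∀ {a b c} {A : Set} → Ccw b a c → Ccw a b c → A
    ccw-asym-elim bac abc = ⊥-elim (ccw-asym abc bac)

  mirror-plane : ∀ {E} → Plane E → OrderType.Plane mirror E
  mirror-plane pl = record
    { ordered = ordered
    ; planar = λ ab cd →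
        (λ (bac , abd , dcb , cda) → proj₂ (planar ab cd) (bac , abd , cda , dcb)) ,
        (λ (abc , bad , dca , cdb) → proj₁ (planar ab cd) (abc , bad , cdb , dca))
    }
    where open Plane pl

module PlaneLemmas {n} (O : OrderType n) {E : Rel (Fin n) 0ℓ} (pl : OrderType.Plane O E) where
  open OrderType O
  open Plane pl

  -- The edge c d is above a b at c and below it at b. The axioms supply the two orientations that
  -- `Crossing` asks for beyond the given ones.
  no-interleaved : ∀ {a b c d} → E a b → E c d → a ≺ c → c ≺ b → b ≺ d → Ccw a b c → ¬ Ccw c d b
  no-interleaved ab cd a≺c c≺b b≺d abc cdb = proj₁ (planar ab cd) (abc , bad , cdb , dca)
    where
    c≺d = ordered cd
    bad = across-left c≺b (ordered ab) b≺d (ccw-cyc abc) (ccw-cyc (ccw-cyc cdb))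
    dca = case ccw-total (≺⇒≢ c≺d ∘ sym) (≺⇒≢ a≺c ∘ sym) (≺⇒≢ (≺-trans a≺c c≺d) ∘ sym) of λ where
      (inj₁ dca) → dca
      (inj₂ cda) → ⊥-elim (ccw-swap abc (ccw-cyc (ccw-cyc (across-right a≺c c≺d c≺b cdb cda))))

  no-nested : ∀ {a b c d} → E a b → E c d → a ≺ c → d ≺ b → Ccw a b c → ¬ Ccw b a d
  no-nested ab cd a≺c d≺b abc bad = proj₁ (planar ab cd) (abc , bad , cdb , dca)
    where
    c≺d = ordered cd
    cdb = ccw-cyc (left-trans (≺-trans c≺d d≺b) (ordered ab) d≺b (ccw-cyc abc) bad)
    dca = ccw-cyc (right-trans (≺-trans a≺c c≺d) (ordered ab) a≺c (ccw-cyc bad) abc)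

  -- At c the edge c d is above a b; at p it runs below p and hence below a b. Which of b and d
  -- comes first decides between the interleaved and the nested pattern.
  no-crossing-between : ∀ {a b c d p} → E a b → E c d → a ≺ c → c ≺ p → p ≺ b → p ≺ d →
                        Ccw a b c → Ccw b a p → ¬ Ccw c d p
  no-crossing-between {a} {b} {c} {d} {p} ab cd a≺c c≺p p≺b p≺d abc bap cdp = go (compare d b)
    where
    c≺b = ≺-trans c≺p p≺b
    bcp : Ccw b c p
    bcp = left-trans c≺b (ordered ab) p≺b (ccw-cyc abc) bap
    go : _ → ⊥
    go (tri≈ _ refl _) = ccw-asym cdp bcp
    go (tri> _ _ b≺d) = no-interleaved ab cd a≺c c≺b b≺d abc
      (right-trans (ordered cd) c≺p c≺b cdp (ccw-cyc bcp))
    go (tri< d≺b _ _) = no-nested ab cd a≺c d≺b abc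
      (left-trans (ordered ab) p≺b d≺b bap bpd)
      where
      bpd : Ccw b p d
      bpd = case ccw-total (≺⇒≢ p≺b ∘ sym) (≺⇒≢ p≺d) (≺⇒≢ d≺b ∘ sym) of λ where
        (inj₁ bpd) → bpd
        (inj₂ pbd) → ⊥-elim (ccw-asym cdp
          (ccw-cyc (across-right c≺p p≺b p≺d pbd (ccw-cyc (ccw-cyc bcp)))))

  -- The edge c d starts above a b and cannot pass through it, so whatever is above c d is above a
  -- b. For p = b the conclusion is absurd: b cannot be above c d.
  stays-above-first : ∀ {a b c d p} → E a b → E c d → a ≺ c → c ≺ p → p ≡ b ⊎ p ≺ b → p ≺ d →
                      Ccw a b c → Ccw c d p → ¬ ¬ Ccw a b p
  stays-above-first ab cd a≺c c≺p (inj₁ refl) p≺d abc cdp _ =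
    no-interleaved ab cd a≺c c≺p p≺d abc cdp
  stays-above-first ab cd a≺c c≺p (inj₂ p≺b) p≺d abc cdp ¬abp =
    case ccw-total (≺⇒≢ (ordered ab)) (≺⇒≢ p≺b ∘ sym) (≺⇒≢ (≺-trans a≺c c≺p)) of λ where
      (inj₁ abp) → ¬abp abp
      (inj₂ bap) → no-crossing-between ab cd a≺c c≺p p≺b p≺d abc bap cdp

  stays-below-second : ∀ {a b c d p} → E a b → E c d → a ≺ c → c ≺ p → p ≺ b → p ≡ d ⊎ p ≺ d →
                       Ccw a b c → Ccw b a p → ¬ ¬ Ccw d c p
  stays-below-second ab cd a≺c c≺p p≺b (inj₁ refl) abc bap _ =
    no-nested ab cd a≺c p≺b abc bap
  stays-below-second ab cd a≺c c≺p p≺b (inj₂ p≺d) abc bap ¬dcp =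
    case ccw-total (≺⇒≢ (ordered cd)) (≺⇒≢ p≺d ∘ sym) (≺⇒≢ c≺p) of λ where
      (inj₁ cdp) → no-crossing-between ab cd a≺c c≺p p≺b p≺d abc bap cdp
      (inj₂ dcp) → ¬dcp dcp

-- Charging the edges of one plane graph to points

module Charging {n} (O : OrderType n) {E : Rel (Fin n) 0ℓ} (E? : Binary.Decidable E)
                (pl : OrderType.Plane O E) where
  open OrderType O
  open Plane pl
  open PlaneLemmas O pl
  private module Mirror = PlaneLemmas (mirror O) (mirror-plane O pl)

  TopRight TopLeft : (u v : Fin n) → Set
  TopRight u v = ∀ w → E u w → ¬ Ccw u v w
  TopLeft  u v = ∀ w → E w v → ¬ Ccw u v w

  InWedge : (u v w p : Fin n) → Set
  InWedge u v w p = u ≺ p × p ≺ v × Ccw u v p × ¬ Ccw u w p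

  -- The edge u w is the next one at u above u v, and p is the leftmost point between them. An edge
  -- separating p from u v would have to start in the wedge left of p or cross u v or u w. So u v is
  -- the edge directly below p, and p determines it.
  record Wedge (u v p : Fin n) : Set where
    field
      w        : Fin n
      edge     : E u w
      above    : Ccw u v w
      lowest   : ∀ x → E u x → Ccw u v x → ¬ Ccw u x w
      inside   : InWedge u v w p
      leftmost : ∀ x → InWedge u v w x → ¬ x ≺ p

    p≼w : p ≡ w ⊎ p ≺ w
    p≼w = case compare p w of λ where
      (tri< p≺w _ _) → inj₂ p≺w
      (tri≈ _ p≡w _) → inj₁ p≡w
      (tri> _ _ w≺p) → ⊥-elim (leftmost w
        (ordered edge , ≺-trans w≺p (proj₁ (proj₂ inside)) , above , λ uww → ccw-≢ (ccw-cyc uww) refl) w≺p)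

  topRight? : ∀ u v → (∃ λ w → E u w × Ccw u v w) ⊎ TopRight u v
  topRight? u v with Fin.any? (λ w → E? u w ×-dec ccw? u v w)
  ... | yes found = inj₁ found
  ... | no  none  = inj₂ λ w uw uvw → none (w , uw , uvw)

  topLeft? : ∀ u v → (∃ λ w → E w v × Ccw u v w) ⊎ TopLeft u v
  topLeft? u v with Fin.any? (λ w → E? w v ×-dec ccw? u v w)
  ... | yes found = inj₁ found
  ... | no  none  = inj₂ λ w wv uvw → none (w , wv , uvw)

  -- If w is left of v, it lies in the wedge itself. Otherwise u w passes above v, and the edge w′
  -- v, which arrives at v from above u v, would cross u w unless w′ lies in the wedge.
  wedge : ∀ {u v} → E u v → (∃ λ w → E u w × Ccw u v w) → (∃ λ w → E w v × Ccw u v w) → ∃ (Wedge u v)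
  wedge {u} {v} uv up (w′ , w′v , uvw′) with
    minimal {P = λ w → E u w × Ccw u v w} (λ x y → ccw? u x y)
      (λ w → E? u w ×-dec ccw? u v w) (λ uww → ccw-≢ (ccw-cyc uww) refl)
      (λ (ux , _) (uy , _) (uz , _) → right-trans (ordered ux) (ordered uy) (ordered uz)) up
  ... | w , (uw , uvw) , low with
    minimal {P = InWedge u v w} _≺?_
      (λ p → (u ≺? p) ×-dec (p ≺? v) ×-dec ccw? u v p ×-dec ¬? (ccw? u w p))
      (≺-irrefl refl) (λ _ _ _ → ≺-trans) nonempty
    where
    nonempty : ∃ (InWedge u v w)
    nonempty with compare w v
    ... | tri< w≺v _ _ = w , ordered uw , w≺v , uvw , λ uww → ccw-≢ (ccw-cyc uww) refl
    ... | tri≈ _ refl _ = ⊥-elim (ccw-≢ (ccw-cyc uvw) refl)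
    ... | tri> _ _ v≺w with compare w′ u
    ...   | tri< w′≺u _ _ = ⊥-elim (Mirror.no-interleaved w′v uw w′≺u (ordered uv) v≺w
                              (ccw-cyc (ccw-cyc (ccw-cyc (ccw-cyc uvw′)))) (ccw-cyc (ccw-cyc uvw)))
    ...   | tri≈ _ refl _ = ⊥-elim (ccw-≢ (ccw-cyc (ccw-cyc uvw′)) refl)
    ...   | tri> _ _ u≺w′ = w′ , u≺w′ , ordered w′v , uvw′ ,
                            λ uww′ → no-nested uw w′v u≺w′ v≺w uww′ (ccw-cyc (ccw-cyc uvw))
  ...   | p , inside , left = p , record
    { w = w ; edge = uw ; above = uvw ; lowest = λ x ux uvx → low x (ux , uvx)
    ; inside = inside ; leftmost = left }

  topRight-unique : ∀ {u v v′} → E u v → E u v′ → TopRight u v → TopRight u v′ → v ≡ v′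
  topRight-unique {u} {v} {v′} uv uv′ top top′ with v Fin.≟ v′
  ... | yes eq = eq
  ... | no v≢v′ = ⊥-elim ([ top v′ uv′ , top′ v uv ∘ ccw-cyc ]′
                    (ccw-total (≺⇒≢ (ordered uv)) v≢v′ (≺⇒≢ (ordered uv′))))

  topLeft-unique : ∀ {u u′ v} → E u v → E u′ v → TopLeft u v → TopLeft u′ v → u ≡ u′
  topLeft-unique {u} {u′} {v} uv u′v top top′ with u Fin.≟ u′
  ... | yes eq = eq
  ... | no u≢u′ = ⊥-elim ([ top u′ u′v , top′ u uv ∘ ccw-cyc ∘ ccw-cyc ]′
                    (ccw-total (≺⇒≢ (ordered uv)) (≺⇒≢ (ordered u′v) ∘ sym) u≢u′))

  -- There are three places for u′. Below u v, the edge u′ w′ stays below u v, and so would p. Above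
  -- u w, the edge u′ v′ stays above u w, and so would p. In between, u′ is a point of the wedge to
  -- the left of p.
  wedge-apex : ∀ {u v u′ v′ p} → E u v → E u′ v′ → Wedge u v p → Wedge u′ v′ p → ¬ u ≺ u′
  wedge-apex {u} {v} {u′} {v′} {p} uv u′v′ W W′ u≺u′ =
    case ccw-total (≺⇒≢ (ordered uv)) (≺⇒≢ u′≺v ∘ sym) (≺⇒≢ u≺u′) of λ where
      (inj₂ vuu′) → Mirror.stays-below-second uv W′.edge u≺u′ u′≺p p≺v W′.p≼w vuu′ uvp ¬u′w′p
      (inj₁ uvu′) → case ccw? u W.w u′ of λ where
        (yes uwu′) → stays-above-first W.edge u′v′ u≺u′ u′≺p W.p≼w p≺v′ uwu′ u′v′p ¬uwp
        (no ¬uwu′) → W.leftmost u′ (u≺u′ , u′≺v , uvu′ , ¬uwu′) u′≺p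
    where
    module W = Wedge W
    module W′ = Wedge W′
    p≺v = proj₁ (proj₂ W.inside)
    uvp = proj₁ (proj₂ (proj₂ W.inside))
    ¬uwp = proj₂ (proj₂ (proj₂ W.inside))
    u′≺p = proj₁ W′.inside
    p≺v′ = proj₁ (proj₂ W′.inside)
    u′v′p = proj₁ (proj₂ (proj₂ W′.inside))
    ¬u′w′p = proj₂ (proj₂ (proj₂ W′.inside))
    u′≺v = ≺-trans u′≺p p≺v

  -- The steeper edge u v′ is u w or above it, so a point above u v′ cannot be weakly below u w.
  wedge-base : ∀ {u v v′ p} → E u v → E u v′ → Wedge u v p → Wedge u v′ p → ¬ Ccw u v v′
  wedge-base {u} {v} {v′} {p} uv uv′ W W′ uvv′ with v′ Fin.≟ Wedge.w W
  ... | yes refl = proj₂ (proj₂ (proj₂ (Wedge.inside W))) (proj₁ (proj₂ (proj₂ (Wedge.inside W′))))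
  ... | no v′≢w = case ccw-total (≺⇒≢ (ordered uv′)) v′≢w (≺⇒≢ (ordered W.edge)) of λ where
      (inj₁ uv′w) → W.lowest v′ uv′ uvv′ uv′w
      (inj₂ v′uw) → proj₂ (proj₂ (proj₂ W.inside))
        (right-trans (ordered W.edge) (ordered uv′) (proj₁ W.inside) (ccw-cyc v′uw)
          (proj₁ (proj₂ (proj₂ (Wedge.inside W′)))))
    where module W = Wedge W

  wedge-unique : ∀ {u v u′ v′ p} → E u v → E u′ v′ → Wedge u v p → Wedge u′ v′ p → (u , v) ≡ (u′ , v′)
  wedge-unique {u} {v} {u′} {v′} uv u′v′ W W′ with compare u u′
  ... | tri< u≺u′ _ _ = ⊥-elim (wedge-apex uv u′v′ W W′ u≺u′)
  ... | tri> _ _ u′≺u = ⊥-elim (wedge-apex u′v′ uv W′ W u′≺u)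
  ... | tri≈ _ refl _ with v Fin.≟ v′
  ...   | yes refl = refl
  ...   | no v≢v′ = ⊥-elim ([ wedge-base uv u′v′ W W′ , wedge-base u′v′ uv W′ W ∘ ccw-cyc ]′
                      (ccw-total (≺⇒≢ (ordered uv)) v≢v′ (≺⇒≢ (ordered u′v′))))

  upperHull-head-unique : ∀ {p p′ q} → UpperHull p q → UpperHull p′ q → p ≡ p′
  upperHull-head-unique {p} {p′} (p≺q , below) (p′≺q , below′) with p Fin.≟ p′
  ... | yes eq = eq
  ... | no p≢p′ = ⊥-elim (ccw-asym (below p′ (p≢p′ ∘ sym) (≺⇒≢ p′≺q))
                    (ccw-cyc (ccw-cyc (below′ p p≢p′ (≺⇒≢ p≺q)))))

  lowerHull-tail-unique : ∀ {p q q′} → LowerHull p q → LowerHull p q′ → q ≡ q′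
  lowerHull-tail-unique {p} {q} {q′} (p≺q , above) (p≺q′ , above′) with q Fin.≟ q′
  ... | yes eq = eq
  ... | no q≢q′ = ⊥-elim (ccw-swap (above q′ (≺⇒≢ p≺q′ ∘ sym) (q≢q′ ∘ sym))
                    (above′ q (≺⇒≢ p≺q ∘ sym) q≢q′))

  -- The hull edge p q is itself the top right edge at p, so no edge needs to be charged to the left slot at q.
  upperHull-topLeft : ∀ {p q u w} → UpperHull p q → E p q → TopLeft u q → E u w → ¬ Ccw u q w
  upperHull-topLeft {p} {q} {u} {w} (p≺q , below) pq top uw uqw with u Fin.≟ p
  ... | yes refl = ccw-asym uqw (below w (≺⇒≢ (ordered uw) ∘ sym) λ { refl → ccw-≢ (ccw-cyc uqw) refl })
  ... | no u≢p = top p pq (ccw-cyc (ccw-cyc (below u u≢p λ { refl → ccw-≢ uqw refl })))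

  -- At a corner of the lower hull no edge passes underneath, so the slot of p for an edge below it
  -- stays empty.
  lowerHull-below : ∀ {p q u v} → LowerHull p q → u ≺ p → p ≺ v → ¬ Ccw u v p
  lowerHull-below {p} {q} {u} {v} (p≺q , above) u≺p p≺v uvp with v Fin.≟ q
  ... | yes refl = ccw-swap (ccw-cyc (ccw-cyc uvp)) (above u (≺⇒≢ u≺p) (≺⇒≢ (≺-trans u≺p p≺q)))
  ... | no v≢q = ccw-asym (across-right u≺p p≺q p≺v (above v (≺⇒≢ p≺v ∘ sym) v≢q)
                   (above u (≺⇒≢ u≺p) (≺⇒≢ (≺-trans u≺p p≺q)))) (ccw-cyc uvp)

-- Counting used and wasted slots over all layers

module Counting {n κ} (O : OrderType n) (left right : Fin n)
  (left-min : ∀ v → ¬ OrderType._≺_ O v left) (right-max : ∀ v → ¬ OrderType._≺_ O right v)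
  (edges : List (Fin κ × Fin n × Fin n)) (edges! : Unique edges)
  (plane : ∀ c → OrderType.Plane O (λ u v → (c , u , v) ∈ edges))
  (ups downs : List (Fin n × Fin n)) (ups! : Unique ups) (downs! : Unique downs)
  (upper : All (λ (p , q) → OrderType.UpperHull O p q × (∀ c → (c , p , q) ∈ edges)) ups)
  (lower : All (λ (p , q) → OrderType.LowerHull O p q) downs) where

  open OrderType O

  private
    E : Fin κ → Rel (Fin n) 0ℓ
    E c u v = (c , u , v) ∈ edges

    _≟E_ : (e f : Fin κ × Fin n × Fin n) → Dec (e ≡ f)
    _≟E_ = ≡-dec Fin._≟_ (≡-dec Fin._≟_ Fin._≟_)

    E? : ∀ c → Binary.Decidable (E c)
    E? c u v = Any.any? ((c , u , v) ≟E_) edges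

    module C c = Charging O (E? c) (plane c)
    module P c = Plane (plane c)

    -- Every point has three slots in every layer: 0F to its right, 1F to its left, 2F for an edge below it.
    Item Slot : Set
    Item = Fin (length edges) ⊎ (Fin κ × (Fin (length ups) ⊎ (Fin (length downs) ⊎ Fin 3)))
    Slot = Fin κ × Fin 3 × Fin n

    pattern edge i = inj₁ i
    pattern up c j = inj₂ (c , inj₁ j)
    pattern down c j = inj₂ (c , inj₂ (inj₁ j))
    pattern extreme c r = inj₂ (c , inj₂ (inj₂ r))

    head tail : ∀ {xs : List (Fin n × Fin n)} → Fin (length xs) → Fin n
    head {xs} j = proj₁ (lookup xs j)
    tail {xs} j = proj₂ (lookup xs j)

    data Edge (c : Fin κ) (i : Fin (length edges)) : (u v : Fin n) → Set where
      is : ∀ {u v} → lookup edges i ≡ (c , u , v) → Edge c i u v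

    -- Nothing leaves `right` to the right or `left` to the left, and a wedge point has an edge end
    -- to its right. Tails of `ups` differ from `left` and heads of `downs` from `right`, so these
    -- three wasted slots are additional to those of the hull.
    extremal : Fin 3 → Fin n
    extremal 0F = right
    extremal 1F = left
    extremal 2F = right

    Charged : Item → Slot → Set
    Charged (edge i) (c , 0F , u) = ∃ λ v → Edge c i u v × C.TopRight c u v
    -- The steeper edge u w records that u v did not get the right slot of u; this is what rules out
    -- the hull edge itself in `edge-up`.
    Charged (edge i) (c , 1F , v) = ∃ λ u → Edge c i u v × C.TopLeft c u v × ∃ λ w → E c u w × Ccw u v w
    Charged (edge i) (c , 2F , p) = ∃ λ u → ∃ λ v → Edge c i u v × C.Wedge c u v p
    Charged (up c′ j) (c , 1F , q) = c′ ≡ c × tail {ups} j ≡ q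
    Charged (down c′ j) (c , 2F , p) = c′ ≡ c × head {downs} j ≡ p
    Charged (extreme c′ r′) (c , r , v) = c′ ≡ c × r′ ≡ r × extremal r ≡ v
    Charged _ _ = ⊥

    Edge⇒E : ∀ {c i u v} → Edge c i u v → E c u v
    Edge⇒E {i = i} (is eq) = subst (_∈ edges) eq (∈-lookup i)

    Edge-injective : ∀ {c i j u v} → Edge c i u v → Edge c j u v → i ≡ j
    Edge-injective (is eq) (is eq′) = lookup-injective edges! (trans eq (sym eq′))

    charged : ∀ x → ∃ (Charged x)
    charged (edge i) with lookup edges i in eq
    ... | c , u , v with C.topRight? c u v
    ...   | inj₂ top = (c , 0F , u) , v , is eq , top
    ...   | inj₁ steeper with C.topLeft? c u v
    ...     | inj₂ top = (c , 1F , v) , u , is eq , top , steeper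
    ...     | inj₁ steeper′ with C.wedge c (Edge⇒E (is {i = i} eq)) steeper steeper′
    ...       | p , W = (c , 2F , p) , u , v , is eq , W
    charged (up c j) = (c , 1F , tail {ups} j) , refl , refl
    charged (down c j) = (c , 2F , head {downs} j) , refl , refl
    charged (extreme c r) = (c , r , extremal r) , refl , refl , refl

    upper-at : ∀ j → UpperHull (head {ups} j) (tail {ups} j) × (∀ c → E c (head {ups} j) (tail {ups} j))
    upper-at j = All.lookup upper (∈-lookup j)

    lower-at : ∀ j → LowerHull (head {downs} j) (tail {downs} j)
    lower-at j = All.lookup lower (∈-lookup j)

    edge-up : ∀ {c i j v} → Charged (edge i) (c , 1F , v) → Charged (up c j) (c , 1F , v) → ⊥
    edge-up {c} {j = j} (u , e , top , w , uw , uvw) (_ , refl) =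
      C.upperHull-topLeft c (proj₁ (upper-at j)) (proj₂ (upper-at j) c) top uw uvw

    edge-down : ∀ {c i j p} → Charged (edge i) (c , 2F , p) → Charged (down c j) (c , 2F , p) → ⊥
    edge-down {c} {j = j} (u , v , e , W) (_ , refl) =
      let u≺p , p≺v , uvp , _ = C.Wedge.inside W in C.lowerHull-below c (lower-at j) u≺p p≺v uvp

    up-left : ∀ {c j v} → Charged (up c j) (c , 1F , v) → left ≢ v
    up-left {j = j} (_ , refl) refl = left-min _ (proj₁ (proj₁ (upper-at j)))

    down-right : ∀ {c j v} → Charged (down c j) (c , 2F , v) → right ≢ v
    down-right {j = j} (_ , refl) refl = right-max _ (proj₁ (lower-at j))

    charged-unique : ∀ {x x′} s → Charged x s → Charged x′ s → x ≡ x′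
    charged-unique {edge i} {edge i′} (c , 0F , u) (v , e , top) (v′ , e′ , top′)
      with refl ← C.topRight-unique c (Edge⇒E e) (Edge⇒E e′) top top′ = cong inj₁ (Edge-injective e e′)
    charged-unique {edge i} {extreme c′ _} (c , 0F , u) (v , e , _) (_ , refl , refl) =
      ⊥-elim (right-max v (P.ordered c (Edge⇒E e)))
    charged-unique {extreme c′ _} {edge i} (c , 0F , u) (_ , refl , refl) (v , e , _) =
      ⊥-elim (right-max v (P.ordered c (Edge⇒E e)))
    charged-unique {edge i} {edge i′} (c , 1F , v) (u , e , top , _) (u′ , e′ , top′ , _)
      with refl ← C.topLeft-unique c (Edge⇒E e) (Edge⇒E e′) top top′ = cong inj₁ (Edge-injective e e′)
    charged-unique {edge i} {up c′ j} (c , 1F , v) x (refl , y) = ⊥-elim (edge-up {i = i} {j} x (refl , y))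
    charged-unique {up c′ j} {edge i} (c , 1F , v) (refl , y) x = ⊥-elim (edge-up {i = i} {j} x (refl , y))
    charged-unique {edge i} {extreme c′ _} (c , 1F , v) (u , e , _) (_ , refl , refl) =
      ⊥-elim (left-min u (P.ordered c (Edge⇒E e)))
    charged-unique {extreme c′ _} {edge i} (c , 1F , v) (_ , refl , refl) (u , e , _) =
      ⊥-elim (left-min u (P.ordered c (Edge⇒E e)))
    charged-unique {up _ j} {up _ j′} (c , 1F , v) (refl , eq) (refl , eq′) =
      cong (λ j → up c j) (lookup-injective ups! (cong₂ _,_
        (C.upperHull-head-unique c (proj₁ (upper-at j))
          (subst (UpperHull (head {ups} j′)) (trans eq′ (sym eq)) (proj₁ (upper-at j′))))
        (trans eq (sym eq′))))
    charged-unique {up _ j} {extreme _ _} (c , 1F , v) (refl , y) (_ , refl , eq) =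
      ⊥-elim (up-left {c} {j} (refl , y) eq)
    charged-unique {extreme _ _} {up _ j} (c , 1F , v) (_ , refl , eq) (refl , y) =
      ⊥-elim (up-left {c} {j} (refl , y) eq)
    charged-unique {edge i} {edge i′} (c , 2F , p) (u , v , e , W) (u′ , v′ , e′ , W′)
      with refl ← C.wedge-unique c (Edge⇒E e) (Edge⇒E e′) W W′ = cong inj₁ (Edge-injective e e′)
    charged-unique {edge i} {down c′ j} (c , 2F , v) x (refl , y) = ⊥-elim (edge-down {i = i} {j} x (refl , y))
    charged-unique {down c′ j} {edge i} (c , 2F , v) (refl , y) x = ⊥-elim (edge-down {i = i} {j} x (refl , y))
    charged-unique {edge i} {extreme c′ _} (c , 2F , v) (u , w , e , W) (_ , refl , refl) =
      ⊥-elim (right-max w (proj₁ (proj₂ (C.Wedge.inside W))))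
    charged-unique {extreme c′ _} {edge i} (c , 2F , v) (_ , refl , refl) (u , w , e , W) =
      ⊥-elim (right-max w (proj₁ (proj₂ (C.Wedge.inside W))))
    charged-unique {down _ j} {down _ j′} (c , 2F , v) (refl , eq) (refl , eq′) =
      cong (λ j → down c j) (lookup-injective downs! (cong₂ _,_ (trans eq (sym eq′))
        (C.lowerHull-tail-unique c (lower-at j)
          (subst (λ p → LowerHull p (tail {downs} j′)) (trans eq′ (sym eq)) (lower-at j′)))))
    charged-unique {down _ j} {extreme _ _} (c , 2F , v) (refl , y) (_ , refl , eq) =
      ⊥-elim (down-right {c} {j} (refl , y) eq)
    charged-unique {extreme _ _} {down _ j} (c , 2F , v) (_ , refl , eq) (refl , y) =
      ⊥-elim (down-right {c} {j} (refl , y) eq)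
    charged-unique {extreme _ _} {extreme _ _} s (refl , refl , _) (refl , refl , _) = refl

  edge-bound : length edges ℕ.+ κ ℕ.* (length ups ℕ.+ (length downs ℕ.+ 3)) ℕ.≤ κ ℕ.* (3 ℕ.* n)
  edge-bound = card-≤ {A = Item} {B = Slot}
    (((↔-id _ ⊎-↔ ((↔-id _ ×-↔ ((↔-id _ ⊎-↔ Fin.+↔⊎) ↔-∘ Fin.+↔⊎)) ↔-∘ Fin.*↔×)) ↔-∘ Fin.+↔⊎))
    ((↔-id _ ×-↔ Fin.*↔×) ↔-∘ Fin.*↔×)
    Charged charged (λ {_} {_} {s} → charged-unique s)

-- Upper hull by gift wrapping

module HullChain {n} (O : OrderType n) where
  open OrderType O

  Leftmost Rightmost : Fin n → Set
  Leftmost p = ∀ v → ¬ v ≺ p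
  Rightmost p = ∀ v → ¬ p ≺ v

  leftmost : Fin n → ∃ Leftmost
  leftmost p = let l , _ , min = minimal _≺?_ (λ _ → yes tt) (≺-irrefl refl) (λ _ _ _ → ≺-trans) (p , tt) in
    l , λ v → min v tt

  data Chain : Fin n → Set where
    end  : ∀ {p} → Rightmost p → Chain p
    step : ∀ {p q} → UpperHull p q → Chain q → Chain p

  chainEdges : ∀ {p} → Chain p → List (Fin n × Fin n)
  chainEdges (end _) = []
  chainEdges (step {p} {q} _ qs) = (p , q) ∷ chainEdges qs

  chainEdges-upper : ∀ {p} (c : Chain p) → All (λ (u , v) → UpperHull u v) (chainEdges c)
  chainEdges-upper (end _) = []
  chainEdges-upper (step pq qs) = pq ∷ chainEdges-upper qs

  chainEdges-≽ : ∀ {p} (c : Chain p) → All (λ (u , v) → ¬ u ≺ p) (chainEdges c)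
  chainEdges-≽ (end _) = []
  chainEdges-≽ (step (p≺q , _) qs) =
    ≺-irrefl refl ∷ All.map (λ u⊀q u≺p → u⊀q (≺-trans u≺p p≺q)) (chainEdges-≽ qs)

  chainEdges-unique : ∀ {p} (c : Chain p) → Unique (chainEdges c)
  chainEdges-unique (end _) = []
  chainEdges-unique (step (p≺q , _) qs) =
    All.map (λ { u⊀q refl → u⊀q p≺q }) (chainEdges-≽ qs) ∷ chainEdges-unique qs

  -- The invariant of gift wrapping. It ensures that all points to the left of p are below every
  -- line from p to the right, so that the steepest point to the right of p is the next hull corner.
  HullStart : Fin n → Set
  HullStart p = Leftmost p ⊎ ∃ λ o → UpperHull o p

  hullStart-below : ∀ {p q w} → HullStart p → p ≺ q → w ≺ p → Ccw q p w
  hullStart-below {w = w} (inj₁ left) p≺q w≺p = ⊥-elim (left w w≺p)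
  hullStart-below {q = q} {w} (inj₂ (o , o≺p , below)) p≺q w≺p
    with below q (≺⇒≢ (≺-trans o≺p p≺q) ∘ sym) (≺⇒≢ p≺q ∘ sym) | w Fin.≟ o
  ... | poq | yes refl = ccw-cyc (ccw-cyc poq)
  ... | poq | no w≢o = ccw-cyc (ccw-cyc (across-left o≺p w≺p p≺q (below w w≢o (≺⇒≢ w≺p)) poq))

  next : ∀ p → HullStart p → (∃ λ q → p ≺ q) → ∃ λ q → UpperHull p q
  next p start right with minimal {P = p ≺_} (λ v w → ccw? p w v) (p ≺?_)
    (λ pww → ccw-≢ (ccw-cyc pww) refl) (λ pu pv pw pvu pwv → right-trans pw pv pu pwv pvu) right
  ... | q , p≺q , max = q , p≺q , λ w w≢p w≢q → case compare p w of λ where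
    (tri< p≺w _ _) → [ (λ pqw → ⊥-elim (max w p≺w pqw)) , (λ qpw → qpw) ]′
      (ccw-total (≺⇒≢ p≺q) (w≢q ∘ sym) (≺⇒≢ p≺w))
    (tri≈ _ p≡w _) → ⊥-elim (w≢p (sym p≡w))
    (tri> _ _ w≺p) → hullStart-below start p≺q w≺p

  chain : ∀ p → HullStart p → Chain p
  chain p start = go p start (spo-noetherian isStrictPartialOrder p)
    where
    go : ∀ p → HullStart p → Acc (flip _≺_) p → Chain p
    go p start (acc rec) with Fin.any? (p ≺?_)
    ... | no none = end λ v p≺v → none (v , p≺v)
    ... | yes right with next p start right
    ...   | q , pq = step pq (go q (inj₂ (p , pq)) (rec (proj₁ pq)))

count-regroup : ∀ n u x a b → n ℕ.+ (u ℕ.+ (u ℕ.+ x)) ℕ.+ 3 ℕ.* (a ℕ.+ (b ℕ.+ 3)) ≡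
          (n ℕ.+ 9) ℕ.+ (2 ℕ.* u ℕ.+ (x ℕ.+ 3 ℕ.* (a ℕ.+ b)))
count-regroup = solve 5 (λ n u x a b → n :+ (u :+ (u :+ x)) :+ con 3 :* (a :+ (b :+ con 3)) :=
  (n :+ con 9) :+ (con 2 :* u :+ (x :+ con 3 :* (a :+ b)))) refl
  where open ℕ.+-*-Solver

-- Rational plane geometry

open +-*-Solver using (solve; Polynomial; _:+_; _:*_; _:-_; :-_; _:=_; con)

*-pos : ∀ {p q} → 0ℚ < p → 0ℚ < q → 0ℚ < p * q
*-pos {p} {q} 0<p 0<q = subst (_< p * q) (ℚ.*-zeroʳ p) (ℚ.*-monoʳ-<-pos p {{positive 0<p}} 0<q)

+-pos : ∀ {p q} → 0ℚ < p → 0ℚ < q → 0ℚ < p + q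
+-pos = ℚ.+-mono-<

*-cancel-pos : ∀ {p q} → 0ℚ < p → 0ℚ < p * q → 0ℚ < q
*-cancel-pos {p} {q} 0<p 0<pq = ℚ.*-cancelˡ-<-nonNeg p {{ℚ.pos⇒nonNeg p {{positive 0<p}}}}
  (subst (_< p * q) (sym (ℚ.*-zeroʳ p)) 0<pq)

<⇒0<- : ∀ {p q} → p < q → 0ℚ < q - p
<⇒0<- {p} {q} p<q = subst (_< q - p) (ℚ.+-inverseʳ p) (ℚ.+-monoˡ-< (- p) p<q)

0<-⇒< : ∀ {p q} → 0ℚ < q - p → p < q
0<-⇒< {p} {q} 0<q-p = subst₂ _<_ (ℚ.+-identityˡ p)
  (solve 2 (λ p q → (q :- p) :+ p := q) refl p q) (ℚ.+-monoˡ-< p 0<q-p)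

neg⇒0<- : ∀ {p} → p < 0ℚ → 0ℚ < - p
neg⇒0<- {p} p<0 = subst (0ℚ <_) (ℚ.+-identityˡ (- p)) (<⇒0<- p<0)

sign : ∀ {p} → p ≢ 0ℚ → 0ℚ < p ⊎ 0ℚ < - p
sign {p} p≢0 with ℚ.<-cmp 0ℚ p
... | tri< 0<p _ _ = inj₁ 0<p
... | tri≈ _ 0≡p _ = contradiction (sym 0≡p) p≢0
... | tri> _ _ p<0 = inj₂ (neg⇒0<- p<0)

combination-pos : ∀ {a b c d e f} → 0ℚ < a → 0ℚ < b → 0ℚ < c → 0ℚ < e → 0ℚ < f →
                  a * d ≡ b * e + c * f → 0ℚ < d
combination-pos a b c e f eq = *-cancel-pos a (subst (0ℚ <_) (sym eq) (+-pos (*-pos b e) (*-pos c f)))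

*-≢0 : ∀ {p q} → p ≢ 0ℚ → q ≢ 0ℚ → p * q ≢ 0ℚ
*-≢0 {p} {q} p≢0 q≢0 pq≡0 with sign p≢0 | sign q≢0
... | inj₁ 0<p | inj₁ 0<q = ℚ.<-irrefl (sym pq≡0) (*-pos 0<p 0<q)
... | inj₁ 0<p | inj₂ q<0 = ℚ.<-irrefl (sym (trans (sym (ℚ.neg-distribʳ-* p q)) (cong -_ pq≡0))) (*-pos 0<p q<0)
... | inj₂ p<0 | inj₁ 0<q = ℚ.<-irrefl (sym (trans (sym (ℚ.neg-distribˡ-* p q)) (cong -_ pq≡0))) (*-pos p<0 0<q)
... | inj₂ p<0 | inj₂ q<0 = ℚ.<-irrefl (sym (trans
  (solve 2 (λ p q → (:- p) :* (:- q) := p :* q) refl p q) pq≡0)) (*-pos p<0 q<0)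

≡⇒-≡0 : ∀ {p q} → p ≡ q → p - q ≡ 0ℚ
≡⇒-≡0 {p} refl = ℚ.+-inverseʳ p

-≡0⇒≡ : ∀ {p q} → p - q ≡ 0ℚ → p ≡ q
-≡0⇒≡ {p} {q} eq = trans (solve 2 (λ p q → p := (p :- q) :+ q) refl p q) (trans (cong (_+ q) eq) (ℚ.+-identityˡ q))

private
  :det : ∀ {n} (ax ay bx by cx cy : Polynomial n) → Polynomial n
  :det ax ay bx by cx cy = (bx :- ax) :* (cy :- ay) :- (by :- ay) :* (cx :- ax)

opaque
  det : Point → Point → Point → ℚ
  det (ax , ay) (bx , by) (cx , cy) = (bx - ax) * (cy - ay) - (by - ay) * (cx - ax)

  det-swap : ∀ a b c → det b a c ≡ - det a b c
  det-swap (ax , ay) (bx , by) (cx , cy) = solve 6 (λ ax ay bx by cx cy →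
    :det bx by ax ay cx cy := :- :det ax ay bx by cx cy) refl ax ay bx by cx cy

  det-cyc : ∀ a b c → det b c a ≡ det a b c
  det-cyc (ax , ay) (bx , by) (cx , cy) = solve 6 (λ ax ay bx by cx cy →
    :det bx by cx cy ax ay := :det ax ay bx by cx cy) refl ax ay bx by cx cy

  det-left : ∀ a b → det a b a ≡ 0ℚ
  det-left (ax , ay) (bx , by) = solve 4 (λ ax ay bx by →
    :det ax ay bx by ax ay := con 0ℚ) refl ax ay bx by

  det-right : ∀ a b → det a b b ≡ 0ℚ
  det-right (ax , ay) (bx , by) = solve 4 (λ ax ay bx by →
    :det ax ay bx by bx by := con 0ℚ) refl ax ay bx by

  -- The abscissa and the height `det u w` are affine coordinates with Jacobian w.x - u.x. Thus
  -- three points of equal height over u w are collinear.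
  det-collinear : ∀ u w a b c → (proj₁ w - proj₁ u) * det a b c ≡
                  (proj₁ b - proj₁ a) * (det u w c - det u w a) - (proj₁ c - proj₁ a) * (det u w b - det u w a)
  det-collinear (ux , uy) (wx , wy) (ax , ay) (bx , by) (cx , cy) = solve 10 (λ ux uy wx wy ax ay bx by cx cy →
    (wx :- ux) :* :det ax ay bx by cx cy :=
    (bx :- ax) :* (:det ux uy wx wy cx cy :- :det ux uy wx wy ax ay) :-
    (cx :- ax) :* (:det ux uy wx wy bx by :- :det ux uy wx wy ax ay)) refl ux uy wx wy ax ay bx by cx cy

  det-triangle : ∀ a b c p → det a b c ≡ det a b p + (det b c p + det c a p)
  det-triangle (ax , ay) (bx , by) (cx , cy) (px , py) = solve 8 (λ ax ay bx by cx cy px py →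
    :det ax ay bx by cx cy := :det ax ay bx by px py :+ (:det bx by cx cy px py :+ :det cx cy ax ay px py))
    refl ax ay bx by cx cy px py

  -- The three-term Grassmann-Plücker relation for p, u, v, w and the vertical point at infinity,
  -- whose determinants are differences of abscissas. The next three identities rearrange it so that
  -- the coefficients are positive in the situation of their axiom.
  slopes-right : ∀ p u v w → (proj₁ v - proj₁ p) * det p u w ≡
                 (proj₁ u - proj₁ p) * det p v w + (proj₁ w - proj₁ p) * det p u v
  slopes-right (px , py) (ux , uy) (vx , vy) (wx , wy) = solve 8 (λ px py ux uy vx vy wx wy →
    (vx :- px) :* :det px py ux uy wx wy :=
    (ux :- px) :* :det px py vx vy wx wy :+ (wx :- px) :* :det px py ux uy vx vy) refl px py ux uy vx vy wx wy

  slopes-left : ∀ p u v w → (proj₁ p - proj₁ v) * det p u w ≡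
                (proj₁ p - proj₁ u) * det p v w + (proj₁ p - proj₁ w) * det p u v
  slopes-left (px , py) (ux , uy) (vx , vy) (wx , wy) = solve 8 (λ px py ux uy vx vy wx wy →
    (px :- vx) :* :det px py ux uy wx wy :=
    (px :- ux) :* :det px py vx vy wx wy :+ (px :- wx) :* :det px py ux uy vx vy) refl px py ux uy vx vy wx wy

  slopes-across-right : ∀ p u v w → (proj₁ v - proj₁ p) * det p w u ≡
                        (proj₁ w - proj₁ p) * det p v u + (proj₁ p - proj₁ u) * det p v w
  slopes-across-right (px , py) (ux , uy) (vx , vy) (wx , wy) = solve 8 (λ px py ux uy vx vy wx wy →
    (vx :- px) :* :det px py wx wy ux uy :=
    (wx :- px) :* :det px py vx vy ux uy :+ (px :- ux) :* :det px py vx vy wx wy) refl px py ux uy vx vy wx wy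

  slopes-across-left : ∀ p u v w → (proj₁ p - proj₁ u) * det p v w ≡
                       (proj₁ p - proj₁ v) * det p u w + (proj₁ w - proj₁ p) * det p u v
  slopes-across-left (px , py) (ux , uy) (vx , vy) (wx , wy) = solve 8 (λ px py ux uy vx vy wx wy →
    (px :- ux) :* :det px py vx vy wx wy :=
    (px :- vx) :* :det px py ux uy wx wy :+ (wx :- px) :* :det px py ux uy vx vy) refl px py ux uy vx vy wx wy

-- A common point of the open segments a b and c d, given by homogeneous weights.
record Cross (a b c d : Point) : Set where
  field
    α β γ δ : ℚ
    0<α : 0ℚ < α
    0<β : 0ℚ < β
    0<γ : 0ℚ < γ
    0<δ : 0ℚ < δ
    weight : α + β ≡ γ + δ
    eqx : α * proj₁ a + β * proj₁ b ≡ γ * proj₁ c + δ * proj₁ d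
    eqy : α * proj₂ a + β * proj₂ b ≡ γ * proj₂ c + δ * proj₂ d

Cross-sym : ∀ {a b c d} → Cross a b c d → Cross c d a b
Cross-sym X = record
  { 0<α = 0<γ ; 0<β = 0<δ ; 0<γ = 0<α ; 0<δ = 0<β
  ; weight = sym weight ; eqx = sym eqx ; eqy = sym eqy }
  where open Cross X

Cross-swapʳ : ∀ {a b c d} → Cross a b c d → Cross a b d c
Cross-swapʳ X = record
  { 0<α = 0<α ; 0<β = 0<β ; 0<γ = 0<δ ; 0<δ = 0<γ
  ; weight = trans weight (ℚ.+-comm γ δ)
  ; eqx = trans eqx (ℚ.+-comm (γ * _) (δ * _)) ; eqy = trans eqy (ℚ.+-comm (γ * _) (δ * _)) }
  where open Cross X

Cross-swapˡ : ∀ {a b c d} → Cross a b c d → Cross b a c d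
Cross-swapˡ = Cross-sym ∘ Cross-swapʳ ∘ Cross-sym

opaque
  unfolding det

  -- Cramer's rule: the weight of an end is the area spanned by the other segment and the opposite
  -- end. Homogeneous weights avoid a division.
  det⇒Cross : ∀ {a b c d} → 0ℚ < det a b c → 0ℚ < det b a d → 0ℚ < det c d b → 0ℚ < det d c a → Cross a b c d
  det⇒Cross {ax , ay} {bx , by} {cx , cy} {dx , dy} abc bad cdb dca = record
    { 0<α = cdb ; 0<β = dca ; 0<γ = bad ; 0<δ = abc
    ; weight = solve 8 (λ ax ay bx by cx cy dx dy →
        :det cx cy dx dy bx by :+ :det dx dy cx cy ax ay :=
        :det bx by ax ay dx dy :+ :det ax ay bx by cx cy) refl ax ay bx by cx cy dx dy
    ; eqx = solve 8 (λ ax ay bx by cx cy dx dy →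
        :det cx cy dx dy bx by :* ax :+ :det dx dy cx cy ax ay :* bx :=
        :det bx by ax ay dx dy :* cx :+ :det ax ay bx by cx cy :* dx) refl ax ay bx by cx cy dx dy
    ; eqy = solve 8 (λ ax ay bx by cx cy dx dy →
        :det cx cy dx dy bx by :* ay :+ :det dx dy cx cy ax ay :* by :=
        :det bx by ax ay dx dy :* cy :+ :det ax ay bx by cx cy :* dy) refl ax ay bx by cx cy dx dy }

-- Eliminates r from the two crossings.
Cross-opposite : ∀ {c q r y z} → Cross c r q y → Cross q r c z → Cross q y c z
Cross-opposite {cx , cy} {qx , qy} {rx , ry} {yx , yy} {zx , zy} X Y = record
  { 0<α = +-pos (*-pos Y.0<β X.0<γ) (*-pos X.0<β Y.0<α) ; 0<β = *-pos Y.0<β X.0<δ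
  ; 0<γ = +-pos (*-pos X.0<β Y.0<γ) (*-pos Y.0<β X.0<α) ; 0<δ = *-pos X.0<β Y.0<δ
  ; weight = begin
      Y.β * X.γ + X.β * Y.α + Y.β * X.δ   ≡⟨ solve 5 (λ β′ γ β α′ δ → β′ :* γ :+ β :* α′ :+ β′ :* δ := β′ :* (γ :+ δ) :+ β :* α′) refl Y.β X.γ X.β Y.α X.δ ⟩
      Y.β * (X.γ + X.δ) + X.β * Y.α       ≡⟨ cong (λ w → Y.β * w + X.β * Y.α) (sym X.weight) ⟩
      Y.β * (X.α + X.β) + X.β * Y.α       ≡⟨ solve 4 (λ β′ α β α′ → β′ :* (α :+ β) :+ β :* α′ := β :* (α′ :+ β′) :+ β′ :* α) refl Y.β X.α X.β Y.α ⟩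
      X.β * (Y.α + Y.β) + Y.β * X.α       ≡⟨ cong (λ w → X.β * w + Y.β * X.α) Y.weight ⟩
      X.β * (Y.γ + Y.δ) + Y.β * X.α       ≡⟨ solve 5 (λ β γ′ δ′ β′ α → β :* (γ′ :+ δ′) :+ β′ :* α := β :* γ′ :+ β′ :* α :+ β :* δ′) refl X.β Y.γ Y.δ Y.β X.α ⟩
      X.β * Y.γ + Y.β * X.α + X.β * Y.δ   ∎
  ; eqx = eliminate cx qx rx yx zx X.eqx Y.eqx ; eqy = eliminate cy qy ry yy zy X.eqy Y.eqy }
  where
  open ≡-Reasoning
  module X = Cross X
  module Y = Cross Y
  eliminate : ∀ c q r y z → X.α * c + X.β * r ≡ X.γ * q + X.δ * y → Y.α * q + Y.β * r ≡ Y.γ * c + Y.δ * z →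
              (Y.β * X.γ + X.β * Y.α) * q + (Y.β * X.δ) * y ≡ (X.β * Y.γ + Y.β * X.α) * c + (X.β * Y.δ) * z
  eliminate c q r y z e e′ = begin
    (Y.β * X.γ + X.β * Y.α) * q + (Y.β * X.δ) * y   ≡⟨ solve 7 (λ β′ γ β α′ δ q y → (β′ :* γ :+ β :* α′) :* q :+ (β′ :* δ) :* y := β′ :* (γ :* q :+ δ :* y) :+ β :* α′ :* q) refl Y.β X.γ X.β Y.α X.δ q y ⟩
    Y.β * (X.γ * q + X.δ * y) + X.β * Y.α * q       ≡⟨ cong (λ w → Y.β * w + X.β * Y.α * q) (sym e) ⟩
    Y.β * (X.α * c + X.β * r) + X.β * Y.α * q       ≡⟨ solve 7 (λ β′ α β α′ c q r → β′ :* (α :* c :+ β :* r) :+ β :* α′ :* q := β :* (α′ :* q :+ β′ :* r) :+ β′ :* α :* c) refl Y.β X.α X.β Y.α c q r ⟩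
    X.β * (Y.α * q + Y.β * r) + Y.β * X.α * c       ≡⟨ cong (λ w → X.β * w + Y.β * X.α * c) e′ ⟩
    X.β * (Y.γ * c + Y.δ * z) + Y.β * X.α * c       ≡⟨ solve 7 (λ β γ′ δ′ β′ α c z → β :* (γ′ :* c :+ δ′ :* z) :+ β′ :* α :* c := (β :* γ′ :+ β′ :* α) :* c :+ (β :* δ′) :* z) refl X.β Y.γ Y.δ Y.β X.α c z ⟩
    (X.β * Y.γ + Y.β * X.α) * c + (X.β * Y.δ) * z   ∎

record Affine (f : Point → ℚ) : Set where
  constructor affine
  field
    k₀ k₁ k₂ : ℚ
    value : ∀ x y → f (x , y) ≡ k₀ + k₁ * x + k₂ * y

opaque
  unfolding det

  det-affine : ∀ a b → Affine (det a b)
  det-affine (ax , ay) (bx , by) = affine ((by - ay) * ax - (bx - ax) * ay) (- (by - ay)) (bx - ax)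
    (solve 6 (λ ax ay bx by x y → :det ax ay bx by x y :=
      ((by :- ay) :* ax :- (bx :- ax) :* ay) :+ (:- (by :- ay)) :* x :+ (bx :- ax) :* y) refl ax ay bx by)

x-affine : Affine proj₁
x-affine = affine 0ℚ 1ℚ 0ℚ (solve 2 (λ x y → x := con 0ℚ :+ con 1ℚ :* x :+ con 0ℚ :* y) refl)

affine-balance : ∀ {f a b c d} → Affine f → (X : Cross a b c d) → let open Cross X in
                 ∀ k → α * (f a - k) + β * (f b - k) ≡ γ * (f c - k) + δ * (f d - k)
affine-balance {f} {a} {b} {c} {d} (affine k₀ k₁ k₂ f≡) X k
  rewrite f≡ (proj₁ a) (proj₂ a) | f≡ (proj₁ b) (proj₂ b) | f≡ (proj₁ c) (proj₂ c) | f≡ (proj₁ d) (proj₂ d) =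
  trans (regroup α β (proj₁ a) (proj₂ a) (proj₁ b) (proj₂ b))
    (trans (cong₂ _+_ (cong₂ _+_ (cong (_* (k₀ - k)) weight) (cong (k₁ *_) eqx)) (cong (k₂ *_) eqy))
      (sym (regroup γ δ (proj₁ c) (proj₂ c) (proj₁ d) (proj₂ d))))
  where
  open Cross X
  regroup : ∀ α β ax ay bx by → α * (k₀ + k₁ * ax + k₂ * ay - k) + β * (k₀ + k₁ * bx + k₂ * by - k)
            ≡ (α + β) * (k₀ - k) + k₁ * (α * ax + β * bx) + k₂ * (α * ay + β * by)
  regroup = solve 10 (λ k₀ k₁ k₂ k α β ax ay bx by →
    α :* (k₀ :+ k₁ :* ax :+ k₂ :* ay :- k) :+ β :* (k₀ :+ k₁ :* bx :+ k₂ :* by :- k) :=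
    (α :+ β) :* (k₀ :- k) :+ k₁ :* (α :* ax :+ β :* bx) :+ k₂ :* (α :* ay :+ β :* by)) refl k₀ k₁ k₂ k

≤⇒0≤- : ∀ {p q} → p ≤ q → 0ℚ ≤ q - p
≤⇒0≤- {p} {q} p≤q = subst (_≤ q - p) (ℚ.+-inverseʳ p) (ℚ.+-monoˡ-≤ (- p) p≤q)

*-nonneg : ∀ {p q} → 0ℚ ≤ p → 0ℚ ≤ q → 0ℚ ≤ p * q
*-nonneg {p} {q} 0≤p 0≤q = subst (_≤ p * q) (ℚ.*-zeroʳ p) (ℚ.*-monoˡ-≤-nonNeg p {{nonNegative 0≤p}} 0≤q)

separated-< : ∀ {f a b c d k} → Affine f → k < f a → k ≤ f b → f c ≤ k → f d ≤ k → ¬ Cross a b c d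
separated-< {f} {a} {b} {c} {d} {k} aff a> b≥ c≤ d≤ X = ℚ.<-irrefl refl (ℚ.<-≤-trans pos nonpos)
  where
  open Cross X
  flipped : γ * (k - f c) + δ * (k - f d) ≡ - (γ * (f c - k) + δ * (f d - k))
  flipped = solve 5 (λ γ δ k c d → γ :* (k :- c) :+ δ :* (k :- d) := :- (γ :* (c :- k) :+ δ :* (d :- k))) refl γ δ k (f c) (f d)
  pos : 0ℚ < α * (f a - k) + β * (f b - k)
  pos = ℚ.+-mono-<-≤ (*-pos 0<α (<⇒0<- a>)) (*-nonneg (ℚ.<⇒≤ 0<β) (≤⇒0≤- b≥))
  nonpos : α * (f a - k) + β * (f b - k) ≤ 0ℚ
  nonpos = subst₂ _≤_ (trans (cong -_ flipped) (trans (solve 1 (λ p → :- (:- p) := p) refl _) (sym (affine-balance aff X k)))) refl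
    (ℚ.neg-antimono-≤ (ℚ.+-mono-≤ (*-nonneg (ℚ.<⇒≤ 0<γ) (≤⇒0≤- c≤)) (*-nonneg (ℚ.<⇒≤ 0<δ) (≤⇒0≤- d≤))))

neg-affine : ∀ {f} → Affine f → Affine (λ p → - f p)
neg-affine {f} (affine k₀ k₁ k₂ f≡) = affine (- k₀) (- k₁) (- k₂) λ x y → trans (cong -_ (f≡ x y))
  (solve 5 (λ k₀ k₁ k₂ x y → :- (k₀ :+ k₁ :* x :+ k₂ :* y) := (:- k₀) :+ (:- k₁) :* x :+ (:- k₂) :* y) refl k₀ k₁ k₂ x y)

-- A weighted mean on one side of the line equals one on the other side, so both lie on the line,
-- and with them every end of positive weight.
separated-≤ : ∀ {f a b c d k} → Affine f → k ≤ f a → k ≤ f b → f c ≤ k → f d ≤ k → Cross a b c d →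
              f a ≡ k × f b ≡ k × f c ≡ k
separated-≤ {f} {a} {b} {c} {d} {k} aff a≥ b≥ c≤ d≤ X =
  ℚ.≤-antisym (ℚ.≮⇒≥ λ k<a → separated-< aff k<a b≥ c≤ d≤ X) a≥ ,
  ℚ.≤-antisym (ℚ.≮⇒≥ λ k<b → separated-< aff k<b a≥ c≤ d≤ (Cross-swapˡ X)) b≥ ,
  ℚ.≤-antisym c≤ (ℚ.≮⇒≥ λ c<k → separated-< (neg-affine aff) (ℚ.neg-antimono-< c<k) (ℚ.neg-antimono-≤ d≤)
    (ℚ.neg-antimono-≤ a≥) (ℚ.neg-antimono-≤ b≥) (Cross-sym X))

record Configuration (n : ℕ) : Set where
  field
    point : Fin n → Point
    x-injective : ∀ {i j} → proj₁ (point i) ≡ proj₁ (point j) → i ≡ j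
    general : ∀ {i j k} → i ≢ j → j ≢ k → i ≢ k → det (point i) (point j) (point k) ≢ 0ℚ

  Δ : (i j k : Fin n) → ℚ
  Δ i j k = det (point i) (point j) (point k)

  x : Fin n → ℚ
  x i = proj₁ (point i)

orderType : ∀ {n} → Configuration n → OrderType n
orderType {n} C = record
  { _≺_ = λ i j → x i < x j
  ; isStrictTotalOrder = record
    { isStrictPartialOrder = record
      { isEquivalence = isEquivalence
      ; irrefl = λ { refl → ℚ.<-irrefl refl }
      ; trans = ℚ.<-trans
      ; <-resp-≈ = (λ { refl p → p }) , (λ { refl p → p }) }
    ; compare = λ i j → case ℚ.<-cmp (x i) (x j) of λ where
        (tri< a b c) → tri< a (b ∘ cong x) c
        (tri≈ a b c) → tri≈ a (x-injective b) c
        (tri> a b c) → tri> a (b ∘ cong x) c }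
  ; Ccw = λ i j k → 0ℚ < Δ i j k
  ; ccw-total = λ {i} {j} {k} i≢j j≢k i≢k → Sum.map₂ (subst (0ℚ <_) (sym (det-swap (point i) (point j) (point k))))
      (sign (general i≢j j≢k i≢k))
  ; ccw-asym = λ {i} {j} {k} ijk jik → ℚ.<-asym (subst (0ℚ <_) (det-swap (point i) (point j) (point k)) jik) (ℚ.neg-antimono-< ijk)
  ; ccw-cyc = λ {i} {j} {k} → subst (0ℚ <_) (sym (det-cyc (point i) (point j) (point k)))
  ; right-trans = λ {p} {u} {v} {w} u< v< w< puv pvw →
      combination-pos (<⇒0<- v<) (<⇒0<- u<) (<⇒0<- w<) pvw puv (slopes-right (point p) (point u) (point v) (point w))
  ; left-trans = λ {p} {u} {v} {w} u< v< w< puv pvw →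
      combination-pos (<⇒0<- v<) (<⇒0<- u<) (<⇒0<- w<) pvw puv (slopes-left (point p) (point u) (point v) (point w))
  ; across-right = λ {p} {u} {v} {w} u< v< w< pvw pvu →
      combination-pos (<⇒0<- v<) (<⇒0<- w<) (<⇒0<- u<) pvu pvw (slopes-across-right (point p) (point u) (point v) (point w))
  ; across-left = λ {p} {u} {v} {w} u< v< w< puv puw →
      combination-pos (<⇒0<- u<) (<⇒0<- v<) (<⇒0<- w<) puw puv (slopes-across-left (point p) (point u) (point v) (point w))
  }
  where open Configuration C

-- Extremal points in a direction

module TopSets {n} (C : Configuration n) where
  open Configuration C

  Crosses : (a b c d : Fin n) → Set
  Crosses a b c d = Cross (point a) (point b) (point c) (point d)

  Uncrossed : (a b : Fin n) → Set
  Uncrossed a b = ∀ c d → c ≢ a → c ≢ b → d ≢ a → d ≢ b → ¬ Crosses a b c d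

  x-≢ : ∀ {i j} → i ≢ j → x j - x i ≢ 0ℚ
  x-≢ i≢j eq = i≢j (sym (x-injective (-≡0⇒≡ eq)))

  Δ-left : ∀ {u w a} → 0ℚ < Δ u w a → a ≢ u
  Δ-left {u} {w} 0<Δ refl = ℚ.<-irrefl (sym (det-left (point u) (point w))) 0<Δ

  Δ-right : ∀ {u w a} → 0ℚ < Δ u w a → a ≢ w
  Δ-right {u} {w} 0<Δ refl = ℚ.<-irrefl (sym (det-right (point u) (point w))) 0<Δ

  same-height⇒collinear : ∀ {u w a b c} → u ≢ w → Δ u w b ≡ Δ u w a → Δ u w c ≡ Δ u w a → Δ a b c ≡ 0ℚ
  same-height⇒collinear {u} {w} {a} {b} {c} u≢w b≡a c≡a with Δ a b c ℚ.≟ 0ℚ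
  ... | yes eq = eq
  ... | no neq = ⊥-elim (*-≢0 (x-≢ u≢w) neq
    (trans (det-collinear (point u) (point w) (point a) (point b) (point c))
      (trans (cong₂ (λ p q → (x b - x a) * p - (x c - x a) * q) (≡⇒-≡0 c≡a) (≡⇒-≡0 b≡a))
        (solve 2 (λ p q → p :* con 0ℚ :- q :* con 0ℚ := con 0ℚ) refl (x b - x a) (x c - x a)))))

  -- A crossing at a weakly separating parallel of u w would put a, b and c at equal height, against
  -- general position. So ties between heights do no harm, and weak maxima are good enough below.
  separates : ∀ {u w a b c d k} → u ≢ w → a ≢ b → c ≢ a → c ≢ b →
              k ≤ Δ u w a → k ≤ Δ u w b → Δ u w c ≤ k → Δ u w d ≤ k → ¬ Crosses a b c d
  separates {u} {w} {a} {b} {c} u≢w a≢b c≢a c≢b a≥ b≥ c≤ d≤ X =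
    let a≡k , b≡k , c≡k = separated-≤ (det-affine (point u) (point w)) a≥ b≥ c≤ d≤ X in
    general a≢b (c≢b ∘ sym) (c≢a ∘ sym)
      (same-height⇒collinear {u} {w} u≢w (trans b≡k (sym a≡k)) (trans c≡k (sym a≡k)))

  argmax : ∀ (f : Fin n → ℚ) {P : Fin n → Set} → (∀ i → Dec (P i)) → ∃ P → ∃ λ m → P m × (∀ i → P i → f i ≤ f m)
  argmax f P? nonempty with minimal {_⊏_ = λ i j → f j < f i} (λ i j → f j ℚ.<? f i) P? (ℚ.<-irrefl refl)
                              (λ _ _ _ p q → ℚ.<-trans q p) nonempty
  ... | m , pm , max = m , pm , λ i pi → ℚ.≮⇒≥ (max i pi)

  -- The parallel of u w through the second highest point b separates a and b from all other points.
  top-pair : ∀ {u w y z} → u ≢ w → y ≢ z → 0ℚ < Δ u w y → 0ℚ < Δ u w z →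
             ∃ λ a → ∃ λ b → a ≢ b × 0ℚ < Δ u w a × 0ℚ < Δ u w b × Uncrossed a b
  top-pair {u} {w} {y} {z} u≢w y≢z 0<y 0<z
    with argmax (Δ u w) {λ _ → ⊤} (λ _ → yes tt) (y , tt)
  ... | a , _ , a-max
    with argmax (Δ u w) {λ i → i ≢ a} (λ i → ¬? (i Fin.≟ a))
           (case y Fin.≟ a of λ { (yes refl) → z , y≢z ∘ sym ; (no y≢a) → y , y≢a })
  ...   | b , b≢a , b-max = a , b , b≢a ∘ sym , ℚ.<-≤-trans 0<y (a-max y tt) , 0<b ,
          λ c d c≢a c≢b d≢a d≢b → separates u≢w (b≢a ∘ sym) c≢a c≢b (a-max b tt) ℚ.≤-refl (b-max c c≢a) (b-max d d≢a)
    where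
    0<b : 0ℚ < Δ u w b
    0<b with y Fin.≟ a
    ... | yes refl = ℚ.<-≤-trans 0<z (b-max z (y≢z ∘ sym))
    ... | no y≢a = ℚ.<-≤-trans 0<y (b-max y y≢a)

  record Avoiding (u w : Fin n) : Set where
    field
      a b  : Fin n
      a≢b  : a ≢ b
      free : Uncrossed a b
      a≢u  : a ≢ u
      a≢w  : a ≢ w
      b≢u  : b ≢ u
      b≢w  : b ≢ w

  avoiding : ∀ {u w y z} → u ≢ w → y ≢ z → 0ℚ < Δ u w y → 0ℚ < Δ u w z → Avoiding u w
  avoiding u≢w y≢z 0<y 0<z = let a , b , a≢b , 0<a , 0<b , free = top-pair u≢w y≢z 0<y 0<z in record
    { a = a ; b = b ; a≢b = a≢b ; free = free
    ; a≢u = Δ-left 0<a ; a≢w = Δ-right 0<a ; b≢u = Δ-left 0<b ; b≢w = Δ-right 0<b }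

  avoiding-sym : ∀ {u w} → Avoiding u w → Avoiding w u
  avoiding-sym A = record { a≢b = a≢b ; free = free ; a≢u = a≢w ; a≢w = a≢u ; b≢u = b≢w ; b≢w = b≢u }
    where open Avoiding A

  -- Among three points off the line u w, two lie on the same side.
  uncrossed-avoiding : 4 ℕ.< n → ∀ {u w} → u ≢ w → Avoiding u w
  uncrossed-avoiding 4<n {u} {w} u≢w =
    let y , y∉ = fresh (u ∷ w ∷ []) (ℕ.<-trans (ℕ.s≤s (ℕ.s≤s (ℕ.s≤s ℕ.z≤n))) 4<n)
        z , z∉ = fresh (y ∷ u ∷ w ∷ []) (ℕ.<-trans (ℕ.s≤s (ℕ.s≤s (ℕ.s≤s (ℕ.s≤s ℕ.z≤n)))) 4<n)
        t , t∉ = fresh (z ∷ y ∷ u ∷ w ∷ []) 4<n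
    in go (z∉ ∘ here) (t∉ ∘ here) (t∉ ∘ there ∘ here)
          (side y (y∉ ∘ here) (y∉ ∘ there ∘ here))
          (side z (z∉ ∘ there ∘ here) (z∉ ∘ there ∘ there ∘ here))
          (side t (t∉ ∘ there ∘ there ∘ here) (t∉ ∘ there ∘ there ∘ there ∘ here))
    where
    Side : Fin n → Set
    Side i = 0ℚ < Δ u w i ⊎ 0ℚ < Δ w u i
    side : ∀ i → i ≢ u → i ≢ w → Side i
    side i i≢u i≢w = Sum.map₂ (subst (0ℚ <_) (sym (det-swap (point u) (point w) (point i))))
      (sign (general u≢w (i≢w ∘ sym) (i≢u ∘ sym)))
    go : ∀ {y z t} → z ≢ y → t ≢ z → t ≢ y → Side y → Side z → Side t → Avoiding u w
    go z≢y _ _ (inj₁ 0<y) (inj₁ 0<z) _ = avoiding u≢w z≢y 0<z 0<y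
    go z≢y _ _ (inj₂ 0<y) (inj₂ 0<z) _ = avoiding-sym (avoiding (u≢w ∘ sym) z≢y 0<z 0<y)
    go _ _ t≢y (inj₁ 0<y) (inj₂ _) (inj₁ 0<t) = avoiding u≢w t≢y 0<t 0<y
    go _ t≢z _ (inj₁ _) (inj₂ 0<z) (inj₂ 0<t) = avoiding-sym (avoiding (u≢w ∘ sym) t≢z 0<t 0<z)
    go _ t≢z _ (inj₂ _) (inj₁ 0<z) (inj₁ 0<t) = avoiding u≢w t≢z 0<t 0<z
    go _ _ t≢y (inj₂ 0<y) (inj₁ _) (inj₂ 0<t) = avoiding-sym (avoiding (u≢w ∘ sym) t≢y 0<t 0<y)

  Supports : (a b : Fin n) → Set
  Supports a b = a ≢ b × (∀ p → p ≢ a → p ≢ b → 0ℚ < Δ a b p)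

  supports-uncrossed : ∀ {a b} → Supports a b → Uncrossed a b
  supports-uncrossed {a} {b} (a≢b , left) c d c≢a c≢b d≢a d≢b =
    -- The direction is reversed, so that a and b have height 0 and all other points negative
    -- height.
    separates {u = b} {w = a} (a≢b ∘ sym) a≢b c≢a c≢b
      (ℚ.≤-reflexive (sym (det-right (point b) (point a))))
      (ℚ.≤-reflexive (sym (det-left (point b) (point a))))
      (below c≢a c≢b) (below d≢a d≢b)
    where
    below : ∀ {p} → p ≢ a → p ≢ b → Δ b a p ≤ 0ℚ
    below {p} p≢a p≢b = subst (_≤ 0ℚ) (sym (det-swap (point a) (point b) (point p)))
      (ℚ.neg-antimono-≤ (ℚ.<⇒≤ (left p p≢a p≢b)))

  -- The two points q and r next to the corner c of a triangular hull, as seen from the opposite side.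
  record Corner (a b c : Fin n) : Set where
    field
      q r : Fin n
      q≢a : q ≢ a
      q≢b : q ≢ b
      q≢c : q ≢ c
      r≢a : r ≢ a
      r≢b : r ≢ b
      r≢c : r ≢ c
      r≢q : r ≢ q
      free : Uncrossed c q
      cr-free : ∀ {d e} → d ≢ c → d ≢ q → d ≢ r → e ≢ c → e ≢ q → e ≢ r → ¬ Crosses c r d e
      qr-free : ∀ {d e} → d ≢ c → d ≢ q → d ≢ r → e ≢ c → e ≢ q → e ≢ r → ¬ Crosses q r d e

  -- By `det-triangle` the areas of b c p and c a p make up the difference in height between c and
  -- p.
  apex : ∀ {a b c p} → Supports a b → Supports b c → Supports c a → p ≢ c → Δ a b p < Δ a b c
  apex {a} {b} {c} {p} (a≢b , ab) (b≢c , bc) (c≢a , ca) p≢c with p Fin.≟ a | p Fin.≟ b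
  ... | yes refl | _ = subst (_< Δ a b c) (sym (det-left (point a) (point b))) (ab c c≢a (b≢c ∘ sym))
  ... | no _ | yes refl = subst (_< Δ a b c) (sym (det-right (point a) (point b))) (ab c c≢a (b≢c ∘ sym))
  ... | no p≢a | no p≢b = 0<-⇒< (subst (0ℚ <_) (sym (trans
      (cong (_- Δ a b p) (det-triangle (point a) (point b) (point c) (point p)))
      (solve 2 (λ p q → (p :+ q) :- p := q) refl (Δ a b p) (Δ b c p + Δ c a p))))
      (+-pos (bc p p≢b p≢c) (ca p p≢c p≢a)))

  corner : 4 ℕ.< n → ∀ {a b c} → Supports a b → Supports b c → Supports c a → Corner a b c
  corner 4<n {a} {b} {c} ab@(a≢b , above) bc ca =
    let z , z∉ = fresh (c ∷ a ∷ b ∷ []) (ℕ.<-trans (ℕ.s≤s (ℕ.s≤s (ℕ.s≤s (ℕ.s≤s ℕ.z≤n)))) 4<n)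
        q , q≢c , q-max = argmax (Δ a b) (λ i → ¬? (i Fin.≟ c)) (z , z∉ ∘ here)
        y , y∉ = fresh (q ∷ c ∷ a ∷ b ∷ []) 4<n
        r , (r≢c , r≢q) , r-max = argmax (Δ a b) (λ i → ¬? (i Fin.≟ c) ×-dec ¬? (i Fin.≟ q))
                                    (y , y∉ ∘ there ∘ here , y∉ ∘ here)
        -- A point outside the hull corners has positive height over a b. The maxima q and r inherit
        -- this and therefore differ from a and b.
        0<q = ℚ.<-≤-trans (above z (z∉ ∘ there ∘ here) (z∉ ∘ there ∘ there ∘ here)) (q-max z (z∉ ∘ here))
        0<r = ℚ.<-≤-trans (above y (y∉ ∘ there ∘ there ∘ here) (y∉ ∘ there ∘ there ∘ there ∘ here))
                (r-max y (y∉ ∘ there ∘ here , y∉ ∘ here))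
    in record
    { q = q ; r = r ; q≢a = Δ-left 0<q ; q≢b = Δ-right 0<q ; q≢c = q≢c
    ; r≢a = Δ-left 0<r ; r≢b = Δ-right 0<r ; r≢c = r≢c ; r≢q = r≢q
    ; free = λ d e d≢c d≢q e≢c e≢q → separates a≢b (q≢c ∘ sym) d≢c d≢q
        (ℚ.<⇒≤ (apex ab bc ca q≢c)) ℚ.≤-refl (q-max d d≢c) (q-max e e≢c)
    ; cr-free = λ {d} {e} d≢c d≢q d≢r e≢c e≢q e≢r → separates a≢b (r≢c ∘ sym) d≢c d≢r
        (ℚ.<⇒≤ (apex ab bc ca r≢c)) ℚ.≤-refl (r-max d (d≢c , d≢q)) (r-max e (e≢c , e≢q))
    ; qr-free = λ {d} {e} d≢c d≢q d≢r e≢c e≢q e≢r → separates a≢b (r≢q ∘ sym) d≢q d≢r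
        (q-max r r≢c) ℚ.≤-refl (r-max d (d≢c , d≢q)) (r-max e (e≢c , e≢q)) }

  -- The height over q y vanishes at q and y, so at the crossing point, and then at p: the three
  -- points would be collinear. This settles the case in which the two blocking edges share their
  -- far end.
  no-shared-crossing : ∀ {p q y} → p ≢ q → y ≢ p → y ≢ q → ¬ Crosses p y q y
  no-shared-crossing {p} {q} {y} p≢q y≢p y≢q X = *-≢0 (λ α≡0 → ℚ.<-irrefl (sym α≡0) 0<α) (general (y≢q ∘ sym) y≢p (p≢q ∘ sym)) αΔ≡0
    where
    open Cross X
    αΔ≡0 : α * Δ q y p ≡ 0ℚ
    αΔ≡0 = begin
      α * Δ q y p                                         ≡⟨ solve 3 (λ α β f → α :* f := α :* (f :- con 0ℚ) :+ β :* (con 0ℚ :- con 0ℚ)) refl α β (Δ q y p) ⟩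
      α * (Δ q y p - 0ℚ) + β * (0ℚ - 0ℚ)                   ≡⟨ cong (λ f → α * (Δ q y p - 0ℚ) + β * (f - 0ℚ)) (sym y≡0) ⟩
      α * (Δ q y p - 0ℚ) + β * (Δ q y y - 0ℚ)              ≡⟨ affine-balance (det-affine (point q) (point y)) X 0ℚ ⟩
      γ * (Δ q y q - 0ℚ) + δ * (Δ q y y - 0ℚ)              ≡⟨ cong₂ (λ e f → γ * (e - 0ℚ) + δ * (f - 0ℚ)) (det-left (point q) (point y)) y≡0 ⟩
      γ * (0ℚ - 0ℚ) + δ * (0ℚ - 0ℚ)                        ≡⟨ solve 2 (λ γ δ → γ :* (con 0ℚ :- con 0ℚ) :+ δ :* (con 0ℚ :- con 0ℚ) := con 0ℚ) refl γ δ ⟩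
      0ℚ                                                  ∎
      where
      open ≡-Reasoning
      y≡0 = det-right (point q) (point y)

-- Three layers are not enough in general position

-- Its iterates on the layer of an uncrossed edge name the two other layers, which receive a copy of
-- that edge.
rotate : Fin 3 → Fin 3
rotate 0F = 1F
rotate 1F = 2F
rotate 2F = 0F

rotate-≢ : ∀ c → rotate c ≢ c
rotate-≢ 0F ()
rotate-≢ 1F ()
rotate-≢ 2F ()

rotate²-≢ : ∀ c → rotate (rotate c) ≢ c
rotate²-≢ 0F ()
rotate²-≢ 1F ()
rotate²-≢ 2F ()

unique-map : ∀ {A B : Set} {P : A → Set} {f : A → B} → (∀ {x y} → P x → P y → f x ≡ f y → x ≡ y) →
             ∀ {xs} → All P xs → Unique xs → Unique (map f xs)
unique-map inj [] [] = []
unique-map inj (px ∷ pxs) (x∉xs ∷ xs!) =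
  All.map⁺ (All.zipWith (λ (py , x≢y) eq → x≢y (inj px py eq)) (pxs , x∉xs)) ∷ unique-map inj pxs xs!

opaque
  pairs : List (Fin 15 × Fin 15)
  pairs = filter (λ (i , j) → i Fin.<? j) (cartesianProduct (allFin 15) (allFin 15))

  pairs-< : All (λ (i , j) → i Fin.< j) pairs
  pairs-< = All.all-filter (λ (i , j) → i Fin.<? j) (cartesianProduct (allFin 15) (allFin 15))

  pairs-unique : Unique pairs
  pairs-unique = Unique.filter⁺ (λ (i , j) → i Fin.<? j)
    (Unique.cartesianProduct⁺ (Unique.allFin⁺ 15) (Unique.allFin⁺ 15))

  ∈-pairs : ∀ {i j} → i Fin.< j → (i , j) ∈ pairs
  ∈-pairs i<j = ∈-filter⁺ (λ (i , j) → i Fin.<? j) (∈-cartesianProduct⁺ (∈-allFin _) (∈-allFin _)) i<j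

  length-pairs : length pairs ≡ 105
  length-pairs = refl

module LowerBound (C : Configuration 15) (layer : Fin 15 → Fin 15 → Fin 3)
  (layer-sym : ∀ i j → layer i j ≡ layer j i)
  (layered : ∀ {a b c d} → a ≢ b → c ≢ d → c ≢ a → c ≢ b → d ≢ a → d ≢ b →
             layer a b ≡ layer c d → ¬ TopSets.Crosses C a b c d) where

  open Configuration C using (point; Δ)
  open TopSets C
  private
    O = orderType C
  open OrderType O
  private
    module Up = HullChain O
    module Down = HullChain (mirror O)

  Edge : Set
  Edge = Fin 15 × Fin 15

  own : Edge → Fin 3
  own (u , v) = layer u v

  -- The pairs are listed by index, while plane graphs store each edge with its left end first.
  orient : Edge → Edge
  orient (i , j) with compare i j
  ... | tri> _ _ _ = j , i
  ... | _ = i , j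

  orient-choice : ∀ i j → orient (i , j) ≡ (i , j) ⊎ orient (i , j) ≡ (j , i)
  orient-choice i j with compare i j
  ... | tri< _ _ _ = inj₁ refl
  ... | tri≈ _ _ _ = inj₁ refl
  ... | tri> _ _ _ = inj₂ refl

  orient-≺ : ∀ {i j} → i ≢ j → proj₁ (orient (i , j)) ≺ proj₂ (orient (i , j))
  orient-≺ {i} {j} i≢j with compare i j
  ... | tri< i≺j _ _ = i≺j
  ... | tri≈ _ i≡j _ = contradiction i≡j i≢j
  ... | tri> _ _ j≺i = j≺i

  orient-injective : ∀ {e f} → proj₁ e Fin.< proj₂ e → proj₁ f Fin.< proj₂ f → orient e ≡ orient f → e ≡ f
  orient-injective {i , j} {k , l} i<j k<l eq with orient-choice i j | orient-choice k l
  ... | inj₁ e | inj₁ f = trans (sym e) (trans eq f)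
  ... | inj₁ e | inj₂ f with refl ← trans (sym e) (trans eq f) = ⊥-elim (Fin.<-asym i<j k<l)
  ... | inj₂ e | inj₁ f with refl ← trans (sym e) (trans eq f) = ⊥-elim (Fin.<-asym i<j k<l)
  ... | inj₂ e | inj₂ f with refl ← trans (sym e) (trans eq f) = refl

  allEdges : List Edge
  allEdges = map orient pairs

  allEdges-unique : Unique allEdges
  allEdges-unique = unique-map orient-injective pairs-< pairs-unique

  Distinct : (a b c d : Fin 15) → Set
  Distinct a b c d = a ≢ b × c ≢ d × c ≢ a × c ≢ b × d ≢ a × d ≢ b

  crossing-distinct : ∀ {a b c d} → Crossing a b c d → Distinct a b c d
  crossing-distinct (abc , bad , cdb , dca) = ccw-≢ abc , ccw-≢ cdb ,
    ccw-≢ (ccw-cyc (ccw-cyc abc)) , ccw-≢ (ccw-cyc abc) ∘ sym ,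
    ccw-≢ (ccw-cyc bad) ∘ sym , ccw-≢ (ccw-cyc (ccw-cyc bad))

  Additional : List Edge → Fin 3 × Edge → Set
  Additional U (c , u , v) = u ≺ v × layer u v ≢ c × (u , v) ∉ U ×
    (∀ {d e} → Distinct u v d e → layer d e ≡ c → ¬ Crosses u v d e)

  orient-complete : ∀ {u v} → u ≺ v → (u , v) ∈ allEdges
  orient-complete {u} {v} u≺v with Fin.<-cmp u v
  ... | tri< u<v _ _ = subst (_∈ allEdges) (forward u≺v) (∈-map⁺ orient (∈-pairs u<v))
    where
    forward : ∀ {u v} → u ≺ v → orient (u , v) ≡ (u , v)
    forward {u} {v} u≺v with compare u v
    ... | tri< _ _ _ = refl
    ... | tri≈ _ _ _ = refl
    ... | tri> _ _ v≺u = ⊥-elim (≺-asym u≺v v≺u)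
  ... | tri≈ _ refl _ = ⊥-elim (≺-irrefl refl u≺v)
  ... | tri> _ _ v<u = subst (_∈ allEdges) (backward u≺v) (∈-map⁺ orient (∈-pairs v<u))
    where
    backward : ∀ {u v} → u ≺ v → orient (v , u) ≡ (u , v)
    backward {u} {v} u≺v with compare v u
    ... | tri< v≺u _ _ = ⊥-elim (≺-asym u≺v v≺u)
    ... | tri≈ _ v≡u _ = ⊥-elim (≺⇒≢ u≺v (sym v≡u))
    ... | tri> _ _ _ = refl

  in-layer : (Edge → Fin 3) → Edge → Fin 3 × Edge
  in-layer f e = f e , e

  module Bound {ups downs : List Edge} (ups! : Unique ups) (downs! : Unique downs)
    (upper : All (λ (p , q) → UpperHull p q) ups) (lower : All (λ (p , q) → LowerHull p q) downs)
    {U : List Edge} (U! : Unique U) (U-free : All (λ (u , v) → u ≺ v × Uncrossed u v) U)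
    (ups⊆U : ∀ {e} → e ∈ ups → e ∈ U)
    {X : List (Fin 3 × Edge)} (X! : Unique X) (X-add : All (Additional U) X)
    (X-single : ∀ {s t} → s ∈ X → t ∈ X → s ≡ t)
    {l r : Fin 15} (l-min : ∀ v → ¬ v ≺ l) (r-max : ∀ v → ¬ r ≺ v) where

    once twice thrice : List (Fin 3 × Edge)
    once = map (in-layer own) allEdges
    twice = map (in-layer (rotate ∘ own)) U
    thrice = map (in-layer (rotate ∘ rotate ∘ own)) U

    edges : List (Fin 3 × Edge)
    edges = once ++ (twice ++ (thrice ++ X))

    in-layer-unique : ∀ f {xs} → Unique xs → Unique (map (in-layer f) xs)
    in-layer-unique f = Unique.map⁺ (cong proj₂)

    ∈-in-layer : ∀ f {xs c e} → (c , e) ∈ map (in-layer f) xs → c ≡ f e × e ∈ xs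
    ∈-in-layer f m with _ , e∈ , refl ← ∈-map⁻ (in-layer f) m = refl , e∈

    edges-unique : Unique edges
    edges-unique =
      Unique.++⁺ (in-layer-unique own allEdges-unique)
        (Unique.++⁺ (in-layer-unique (rotate ∘ own) U!)
          (Unique.++⁺ (in-layer-unique (rotate ∘ rotate ∘ own) U!) X!
            λ (m , x) → proj₁ (proj₂ (proj₂ (All.lookup X-add x))) (proj₂ (∈-in-layer _ m)))
          λ (m , x) → case ∈-++⁻ thrice x of λ where
            (inj₁ t) → rotate-≢ _ (trans (sym (proj₁ (∈-in-layer _ t))) (proj₁ (∈-in-layer _ m)))
            (inj₂ x) → proj₁ (proj₂ (proj₂ (All.lookup X-add x))) (proj₂ (∈-in-layer _ m)))
        λ (m , x) → case ∈-++⁻ twice x of λ where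
          (inj₁ t) → rotate-≢ _ (trans (sym (proj₁ (∈-in-layer _ t))) (proj₁ (∈-in-layer own m)))
          (inj₂ x) → case ∈-++⁻ thrice x of λ where
            (inj₁ t) → rotate²-≢ _ (trans (sym (proj₁ (∈-in-layer _ t))) (proj₁ (∈-in-layer own m)))
            (inj₂ x) → proj₁ (proj₂ (All.lookup X-add x)) (sym (proj₁ (∈-in-layer own m)))

    data Reason (c : Fin 3) (u v : Fin 15) : Set where
      original   : layer u v ≡ c → Reason c u v
      uncrossed  : Uncrossed u v → Reason c u v
      additional : (c , u , v) ∈ X → Reason c u v

    reason : ∀ {c u v} → (c , u , v) ∈ edges → u ≺ v × Reason c u v
    reason m with ∈-++⁻ once m
    ... | inj₁ m with _ , e , refl ← ∈-map⁻ (in-layer own) m | (i , j) , ij , refl ← ∈-map⁻ orient (proj₂ (∈-in-layer own m)) =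
      orient-≺ (Fin.<⇒≢ (All.lookup pairs-< ij)) , original refl
    ... | inj₂ m with ∈-++⁻ twice m
    ...   | inj₁ m = let u≺v , free = All.lookup U-free (proj₂ (∈-in-layer _ m)) in u≺v , uncrossed free
    ...   | inj₂ m with ∈-++⁻ thrice m
    ...     | inj₁ m = let u≺v , free = All.lookup U-free (proj₂ (∈-in-layer _ m)) in u≺v , uncrossed free
    ...     | inj₂ x = proj₁ (All.lookup X-add x) , additional x

    compatible : ∀ {c u v d e} → Reason c u v → Reason c d e → Distinct u v d e → ¬ Crosses u v d e
    compatible (original uv) (original de) (u≢v , d≢e , d≢u , d≢v , e≢u , e≢v) =
      layered u≢v d≢e d≢u d≢v e≢u e≢v (trans uv (sym de))
    compatible (uncrossed free) _ (u≢v , d≢e , d≢u , d≢v , e≢u , e≢v) = free _ _ d≢u d≢v e≢u e≢v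
    compatible _ (uncrossed free) (u≢v , d≢e , d≢u , d≢v , e≢u , e≢v) =
      free _ _ (d≢u ∘ sym) (e≢u ∘ sym) (d≢v ∘ sym) (e≢v ∘ sym) ∘ Cross-sym
    compatible (additional x) (original de) D = proj₂ (proj₂ (proj₂ (All.lookup X-add x))) D de
    compatible (original uv) (additional x) (u≢v , d≢e , d≢u , d≢v , e≢u , e≢v) =
      proj₂ (proj₂ (proj₂ (All.lookup X-add x)))
        (d≢e , u≢v , d≢u ∘ sym , e≢u ∘ sym , d≢v ∘ sym , e≢v ∘ sym) uv ∘ Cross-sym
    -- `X` has at most one element, so the two edges coincide and cannot have four different ends.
    compatible (additional x) (additional y) (u≢v , d≢e , d≢u , _) _ =
      d≢u (cong (proj₁ ∘ proj₂) (X-single y x))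

    crossing⇒Cross : ∀ {a b c d} → Crossing a b c d → Crosses a b c d
    crossing⇒Cross (abc , bad , cdb , dca) = det⇒Cross abc bad cdb dca

    planes : ∀ c → Plane (λ u v → (c , u , v) ∈ edges)
    planes c = record
      { ordered = proj₁ ∘ reason
      ; planar = λ ab cd →
          (λ X → compatible (proj₂ (reason ab)) (proj₂ (reason cd)) (crossing-distinct X) (crossing⇒Cross X)) ,
          (λ X → let b≢a , c≢d , c≢b , c≢a , d≢b , d≢a = crossing-distinct X in
            compatible (proj₂ (reason ab)) (proj₂ (reason cd)) (b≢a ∘ sym , c≢d , c≢a , c≢b , d≢a , d≢b)
              (Cross-swapˡ (crossing⇒Cross X))) }

    every-layer : ∀ c {e} → e ∈ U → (c , e) ∈ edges
    every-layer c {e} e∈U with c Fin.≟ own e | c Fin.≟ rotate (own e) | c Fin.≟ rotate (rotate (own e))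
    ... | yes refl | _ | _ = ∈-++⁺ˡ (∈-map⁺ (in-layer own) (orient-complete (proj₁ (All.lookup U-free e∈U))))
    ... | no _ | yes refl | _ = ∈-++⁺ʳ once (∈-++⁺ˡ (∈-map⁺ (in-layer (rotate ∘ own)) e∈U))
    ... | no _ | no _ | yes refl =
      ∈-++⁺ʳ once (∈-++⁺ʳ twice (∈-++⁺ˡ (∈-map⁺ (in-layer (rotate ∘ rotate ∘ own)) e∈U)))
    ... | no ≢0 | no ≢1 | no ≢2 = ⊥-elim (exhausted c (own e) ≢0 ≢1 ≢2)
      where
      exhausted : ∀ c d → c ≢ d → c ≢ rotate d → c ≢ rotate (rotate d) → ⊥
      exhausted 0F 0F a b c = a refl
      exhausted 0F 1F a b c = c refl
      exhausted 0F 2F a b c = b refl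
      exhausted 1F 0F a b c = b refl
      exhausted 1F 1F a b c = a refl
      exhausted 1F 2F a b c = c refl
      exhausted 2F 0F a b c = c refl
      exhausted 2F 1F a b c = b refl
      exhausted 2F 2F a b c = a refl

    length-edges : length edges ≡ 105 ℕ.+ (length U ℕ.+ (length U ℕ.+ length X))
    length-edges = begin
      length edges ≡⟨ length-++ once ⟩
      length once ℕ.+ length (twice ++ (thrice ++ X)) ≡⟨ cong₂ ℕ._+_ (trans (length-map (in-layer own) allEdges) (trans (length-map orient pairs) length-pairs)) (length-++ twice) ⟩
      105 ℕ.+ (length twice ℕ.+ length (thrice ++ X)) ≡⟨ cong (105 ℕ.+_) (cong₂ ℕ._+_ (length-map (in-layer (rotate ∘ own)) U) (length-++ thrice)) ⟩
      105 ℕ.+ (length U ℕ.+ (length thrice ℕ.+ length X)) ≡⟨ cong (λ k → 105 ℕ.+ (length U ℕ.+ (k ℕ.+ length X))) (length-map (in-layer (rotate ∘ rotate ∘ own)) U) ⟩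
      105 ℕ.+ (length U ℕ.+ (length U ℕ.+ length X)) ∎
      where open ≡-Reasoning

    bound : 2 ℕ.* length U ℕ.+ (length X ℕ.+ 3 ℕ.* (length ups ℕ.+ length downs)) ℕ.≤ 21
    -- Here 114 = 105 + 3 · 3 counts the edges of the complete graph and the extreme slots, and 135
    -- = 3 · (3 · 15) counts all slots.
    bound = ℕ.+-cancelˡ-≤ 114 _ _ (subst (ℕ._≤ 135) total
      (Counting.edge-bound O l r l-min r-max edges edges-unique planes ups downs ups! downs!
        (All.tabulate λ {e} e∈ → All.lookup upper e∈ , λ c → every-layer c (ups⊆U e∈)) lower))
      where
      total : length edges ℕ.+ 3 ℕ.* (length ups ℕ.+ (length downs ℕ.+ 3)) ≡
              114 ℕ.+ (2 ℕ.* length U ℕ.+ (length X ℕ.+ 3 ℕ.* (length ups ℕ.+ length downs)))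
      total = trans (cong (ℕ._+ 3 ℕ.* (length ups ℕ.+ (length downs ℕ.+ 3))) length-edges)
        (count-regroup 105 (length U) (length X) (length ups) (length downs))

  uncrossed-sym : ∀ {a b} → Uncrossed a b → Uncrossed b a
  uncrossed-sym free c d c≢b c≢a d≢b d≢a = free c d c≢a c≢b d≢a d≢b ∘ Cross-swapˡ

  upper-supports : ∀ {p q} → UpperHull p q → Supports q p
  upper-supports (p≺q , below) = ≺⇒≢ p≺q ∘ sym , λ w w≢q w≢p → below w w≢p w≢q

  lower-supports : ∀ {p q} → LowerHull p q → Supports p q
  lower-supports (p≺q , above) = ≺⇒≢ p≺q , above

  upper-lower-disjoint : ∀ {p q} → UpperHull p q → ¬ LowerHull p q
  upper-lower-disjoint {p} {q} (_ , below) (_ , above) =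
    let z , z∉ = fresh (p ∷ q ∷ []) (ℕ.s≤s (ℕ.s≤s (ℕ.s≤s ℕ.z≤n)))
        z≢p = z∉ ∘ here
        z≢q = z∉ ∘ there ∘ here
    in ccw-asym (above z z≢p z≢q) (below z z≢p z≢q)

  orient-fst : ∀ {i j k l} → orient (i , j) ≡ orient (k , l) → i ≡ k ⊎ i ≡ l
  orient-fst {i} {j} {k} {l} eq with orient-choice i j | orient-choice k l
  ... | inj₁ e | inj₁ f with refl ← trans (sym e) (trans eq f) = inj₁ refl
  ... | inj₁ e | inj₂ f with refl ← trans (sym e) (trans eq f) = inj₂ refl
  ... | inj₂ e | inj₁ f with refl ← trans (sym e) (trans eq f) = inj₂ refl
  ... | inj₂ e | inj₂ f with refl ← trans (sym e) (trans eq f) = inj₁ refl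

  orient-snd : ∀ {i j k l} → orient (i , j) ≡ orient (k , l) → j ≡ k ⊎ j ≡ l
  orient-snd {i} {j} {k} {l} eq with orient-choice i j | orient-choice k l
  ... | inj₁ e | inj₁ f with refl ← trans (sym e) (trans eq f) = inj₂ refl
  ... | inj₁ e | inj₂ f with refl ← trans (sym e) (trans eq f) = inj₁ refl
  ... | inj₂ e | inj₁ f with refl ← trans (sym e) (trans eq f) = inj₁ refl
  ... | inj₂ e | inj₂ f with refl ← trans (sym e) (trans eq f) = inj₂ refl

  orient-elim : ∀ (P : Edge → Set) {i j} → P (i , j) → P (j , i) → P (orient (i , j))
  orient-elim P {i} {j} ij ji with orient-choice i j
  ... | inj₁ eq = subst P (sym eq) ij
  ... | inj₂ eq = subst P (sym eq) ji

  orient-free : ∀ {i j} → i ≢ j → Uncrossed i j → proj₁ (orient (i , j)) ≺ proj₂ (orient (i , j)) ×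
                Uncrossed (proj₁ (orient (i , j))) (proj₂ (orient (i , j)))
  orient-free {i} {j} i≢j free = orient-≺ i≢j ,
    orient-elim (λ (u , v) → Uncrossed u v) {i} {j} free (uncrossed-sym free)

  chain-end : ∀ {p} → Up.Chain p → ∃ Up.Rightmost
  chain-end {p} (HullChain.end max) = p , max
  chain-end (HullChain.step _ c) = chain-end c

  module Shape {l : Fin 15} (l-min : ∀ v → ¬ v ≺ l) (up : Up.Chain l) (down : Down.Chain l) where

    ups downs hull : List Edge
    ups = Up.chainEdges up
    downs = Down.chainEdges down
    hull = ups ++ downs

    upper : All (λ (p , q) → UpperHull p q) ups
    upper = Up.chainEdges-upper up

    lower : All (λ (p , q) → LowerHull p q) downs
    lower = Down.chainEdges-upper down

    hull-unique : Unique hull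
    hull-unique = Unique.++⁺ (Up.chainEdges-unique up) (Down.chainEdges-unique down)
      λ (u , d) → upper-lower-disjoint (All.lookup upper u) (All.lookup lower d)

    hull-free : All (λ (u , v) → u ≺ v × Uncrossed u v) hull
    hull-free = All.++⁺
      (All.map (λ h → proj₁ h , uncrossed-sym (supports-uncrossed (upper-supports h))) upper)
      (All.map (λ h → proj₁ h , supports-uncrossed (lower-supports h)) lower)

    hull-bound : (N : List Edge) → Unique (N ++ hull) → All (λ (u , v) → u ≺ v × Uncrossed u v) N →
                 (X : List (Fin 3 × Edge)) → Unique X → All (Additional (N ++ hull)) X →
                 (∀ {s t} → s ∈ X → t ∈ X → s ≡ t) →
                 2 ℕ.* length (N ++ hull) ℕ.+ (length X ℕ.+ 3 ℕ.* (length ups ℕ.+ length downs)) ℕ.≤ 21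
    hull-bound N N! N-free X X! X-add X-single =
      Bound.bound (Up.chainEdges-unique up) (Down.chainEdges-unique down) upper lower
        N! (All.++⁺ N-free hull-free) (∈-++⁺ʳ N ∘ ∈-++⁺ˡ) X! X-add X-single l-min (proj₂ (chain-end up))

    hull-≤4 : ¬ 5 ℕ.≤ length ups ℕ.+ length downs
    -- With U the set of hull edges the bound reads 5h ≤ 21, whereas h ≥ 5 gives at least 25 = 22 +
    -- 3.
    hull-≤4 5≤h = ℕ.<⇒≱ (ℕ.≤-trans (ℕ.m≤m+n 22 3) (ℕ.*-monoʳ-≤ 5 5≤h)) (subst (ℕ._≤ 21)
      (trans (cong (λ k → 2 ℕ.* k ℕ.+ 3 ℕ.* (length ups ℕ.+ length downs)) (length-++ ups))
             (sym (ℕ.*-distribʳ-+ (length ups ℕ.+ length downs) 2 3)))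
      (hull-bound [] hull-unique [] [] [] [] (λ ())))

    module Quadrilateral (h≡4 : length ups ℕ.+ length downs ≡ 4) {v w} (v≢w : v ≢ w)
      (cover : All (λ (p , q) → (p ≡ v ⊎ q ≡ v) ⊎ (p ≡ w ⊎ q ≡ w)) hull) where

      -- Every hull edge ends at one of the opposite corners v and w, so an uncrossed edge that
      -- avoids both is a fifth member of U, and 2 · 5 + 3 · 4 = 22.
      not-avoidable : ¬ Avoiding v w
      not-avoidable A = ℕ.1+n≰n (subst₂ (λ k h → 2 ℕ.* suc k ℕ.+ (0 ℕ.+ 3 ℕ.* h) ℕ.≤ 21)
        (trans (length-++ ups) h≡4) h≡4
        (hull-bound (orient (a , b) ∷ []) (All.tabulate new ∷ hull-unique) (orient-free a≢b free ∷ [])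
          [] [] [] (λ ())))
        where
        open Avoiding A
        Misses : Edge → Set
        Misses (p , q) = (p ≢ v × q ≢ v) × (p ≢ w × q ≢ w)
        misses : Misses (orient (a , b))
        misses = orient-elim Misses {a} {b} ((a≢u , b≢u) , (a≢w , b≢w)) ((b≢u , a≢u) , (b≢w , a≢w))
        new : ∀ {e} → e ∈ hull → orient (a , b) ≢ e
        new e∈ refl with All.lookup cover e∈
        ... | inj₁ (inj₁ eq) = proj₁ (proj₁ misses) eq
        ... | inj₁ (inj₂ eq) = proj₂ (proj₁ misses) eq
        ... | inj₂ (inj₁ eq) = proj₁ (proj₂ misses) eq
        ... | inj₂ (inj₂ eq) = proj₂ (proj₂ misses) eq

      impossible : ⊥
      impossible = not-avoidable (uncrossed-avoiding (ℕ.m≤m+n 5 10) v≢w)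

    module Triangle (h≡3 : length ups ℕ.+ length downs ≡ 3) {a b c} (a≢b : a ≢ b) (b≢c : b ≢ c) (c≢a : c ≢ a)
      (cover : All (λ (p , q) → (p ≡ a ⊎ p ≡ b ⊎ p ≡ c) × (q ≡ a ⊎ q ≡ b ⊎ q ≡ c)) hull)
      (corner-a : Corner b c a) (corner-b : Corner c a b) (corner-c : Corner a b c) where

      module A = Corner corner-a
      module B = Corner corner-b
      module K = Corner corner-c
      open K using (q; r; q≢a; q≢b; q≢c; r≢a; r≢b; r≢c; r≢q)

      not-hull : ∀ {p s} → s ≢ a → s ≢ b → s ≢ c → orient (p , s) ∉ hull
      not-hull {p} {s} s≢a s≢b s≢c with orient-choice p s
      ... | inj₁ eq = λ m → [ s≢a , [ s≢b , s≢c ]′ ]′ (proj₂ (All.lookup cover (subst (_∈ hull) eq m)))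
      ... | inj₂ eq = λ m → [ s≢a , [ s≢b , s≢c ]′ ]′ (proj₁ (All.lookup cover (subst (_∈ hull) eq m)))

      N : List Edge
      N = orient (a , A.q) ∷ orient (b , B.q) ∷ orient (c , q) ∷ []

      N-free : All (λ (u , v) → u ≺ v × Uncrossed u v) N
      N-free = orient-free (A.q≢c ∘ sym) A.free ∷ orient-free (B.q≢c ∘ sym) B.free ∷
               orient-free (q≢c ∘ sym) K.free ∷ []

      N-unique : Unique (N ++ hull)
      N-unique =
        ([ a≢b , B.q≢b ∘ sym ]′ ∘ orient-fst ∷ [ c≢a ∘ sym , q≢a ∘ sym ]′ ∘ orient-fst ∷
          All.tabulate λ { m refl → not-hull A.q≢c A.q≢a A.q≢b m }) ∷
        ([ b≢c , q≢b ∘ sym ]′ ∘ orient-fst ∷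
          All.tabulate λ { m refl → not-hull B.q≢b B.q≢c B.q≢a m }) ∷
        (All.tabulate λ { m refl → not-hull q≢a q≢b q≢c m }) ∷
        hull-unique

      -- The three layers contain c r and r q only once each, so some layer k contains neither.
      k-fresh : ∃ λ k → k ∉ layer c r ∷ layer q r ∷ []
      k-fresh = fresh (layer c r ∷ layer q r ∷ []) (ℕ.s≤s (ℕ.s≤s (ℕ.s≤s ℕ.z≤n)))

      k : Fin 3
      k = proj₁ k-fresh

      Addable : (s : Fin 15) → Set
      Addable s = ∀ {d e} → Distinct s r d e → layer d e ≡ k → ¬ Crosses s r d e

      -- Six uncrossed edges and one extra edge give 2 · 6 + 1 + 3 · 3 = 22.
      not-addable : ∀ {s} → s ≢ r → layer s r ≢ k → orient (s , r) ∉ N ++ hull → ¬ Addable s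
      not-addable {s} s≢r other new add = ℕ.1+n≰n (subst₂ (λ u h → 2 ℕ.* (3 ℕ.+ u) ℕ.+ (1 ℕ.+ 3 ℕ.* h) ℕ.≤ 21)
        (trans (length-++ ups) h≡3) h≡3
        (hull-bound N N-unique N-free ((k , orient (s , r)) ∷ []) ([] ∷ [])
          ((orient-≺ s≢r ,
            orient-elim (λ (u , v) → layer u v ≢ k) {s} {r} other (other ∘ trans (layer-sym s r)) ,
            new ,
            λ {d} {e} → orient-elim (λ (u , v) → ∀ {d e} → Distinct u v d e → layer d e ≡ k → ¬ Crosses u v d e) {s} {r} add
              (λ (u≢v , d≢e , d≢u , d≢v , e≢u , e≢v) de → add (u≢v ∘ sym , d≢e , d≢v , d≢u , e≢v , e≢u) de ∘ Cross-swapˡ))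
           ∷ [])
          λ { (here refl) (here refl) → refl }))

      cr-new : orient (c , r) ∉ N ++ hull
      cr-new (here eq) = [ c≢a , A.q≢b ∘ sym ]′ (orient-fst eq)
      cr-new (there (here eq)) = [ b≢c ∘ sym , B.q≢a ∘ sym ]′ (orient-fst eq)
      cr-new (there (there (here eq))) = [ r≢c , r≢q ]′ (orient-snd eq)
      cr-new (there (there (there m))) = not-hull r≢a r≢b r≢c m

      qr-new : orient (q , r) ∉ N ++ hull
      qr-new (here eq) = [ q≢a ∘ sym , r≢a ∘ sym ]′ (orient-fst (sym eq))
      qr-new (there (here eq)) = [ q≢b ∘ sym , r≢b ∘ sym ]′ (orient-fst (sym eq))
      qr-new (there (there (here eq))) = [ r≢c , r≢q ]′ (orient-snd eq)
      qr-new (there (there (there m))) = not-hull r≢a r≢b r≢c m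

      -- Only edges at q can cross c r, and only edges at c can cross q r.
      Blocked : (s t : Fin 15) → Set
      Blocked s t = ∃ λ y → y ≢ s × y ≢ t × layer t y ≡ k × Crosses s r t y

      blocked : ∀ {s t} → (∀ {d e} → d ≢ s → d ≢ t → d ≢ r → e ≢ s → e ≢ t → e ≢ r → ¬ Crosses s r d e) →
                ∀ {d e} → Distinct s r d e → layer d e ≡ k → Crosses s r d e → Blocked s t
      blocked {s} {t} others {d} {e} (_ , d≢e , d≢s , d≢r , e≢s , e≢r) de X with d Fin.≟ t | e Fin.≟ t
      ... | yes refl | _ = e , e≢s , d≢e ∘ sym , de , X
      ... | no _ | yes refl = d , d≢s , d≢e , trans (layer-sym e d) de , Cross-swapʳ X
      ... | no d≢t | no e≢t = ⊥-elim (others d≢s d≢t d≢r e≢s e≢t e≢r X)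

      both-blocked : Blocked c q → ¬ Blocked q c
      both-blocked (y , y≢c , y≢q , qy , X) (z , z≢q , z≢c , cz , Y) with y Fin.≟ z
      ... | yes refl = no-shared-crossing q≢c y≢q y≢c (Cross-opposite X Y)
      ... | no y≢z = layered (y≢q ∘ sym) (z≢c ∘ sym) (q≢c ∘ sym) (y≢c ∘ sym) z≢q (y≢z ∘ sym)
                       (trans qy (sym cz)) (Cross-opposite X Y)

      impossible : ⊥
      impossible =
        -- `Addable` is itself a negation, so refuting it supplies a blocking crossing; the two
        -- refutations are nested in order to have both crossings at hand.
        not-addable (r≢c ∘ sym) (proj₂ k-fresh ∘ here ∘ sym) cr-new λ D de X →
        not-addable (r≢q ∘ sym) (proj₂ k-fresh ∘ there ∘ here ∘ sym) qr-new λ D′ de′ Y →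
        both-blocked (blocked K.cr-free D de X)
          (blocked (λ d≢q d≢c d≢r e≢q e≢c e≢r → K.qr-free d≢c d≢q d≢r e≢c e≢q e≢r) D′ de′ Y)

  rightmost-unique : ∀ {q q′} → Up.Rightmost q → Up.Rightmost q′ → q ≡ q′
  rightmost-unique {q} {q′} max max′ with compare q q′
  ... | tri< q≺q′ _ _ = ⊥-elim (max q′ q≺q′)
  ... | tri≈ _ q≡q′ _ = q≡q′
  ... | tri> _ _ q′≺q = ⊥-elim (max′ q q′≺q)

  not-both-ends : ∀ {l} → Up.Leftmost l → ¬ Up.Rightmost l
  not-both-ends {l} min max with fresh (l ∷ []) (ℕ.s≤s (ℕ.s≤s ℕ.z≤n))
  ... | z , z∉ with compare z l
  ...   | tri< z≺l _ _ = min z z≺l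
  ...   | tri≈ _ z≡l _ = z∉ (here z≡l)
  ...   | tri> _ _ l≺z = max z l≺z

  triangle : ∀ {l} (l-min : ∀ v → ¬ v ≺ l) (up : Up.Chain l) (down : Down.Chain l) →
             let open Shape l-min up down in length ups ℕ.+ length downs ≡ 3 → ∀ {a b c} →
             Supports a b → Supports b c → Supports c a →
             All (λ (p , q) → (p ≡ a ⊎ p ≡ b ⊎ p ≡ c) × (q ≡ a ⊎ q ≡ b ⊎ q ≡ c)) hull → ⊥
  triangle l-min up down h≡3 ab bc ca cover =
    Shape.Triangle.impossible l-min up down h≡3 (proj₁ ab) (proj₁ bc) (proj₁ ca) cover
      (corner (ℕ.m≤m+n 5 10) bc ca ab) (corner (ℕ.m≤m+n 5 10) ca ab bc) (corner (ℕ.m≤m+n 5 10) ab bc ca)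

  -- The split is by the numbers of upper and lower hull edges. An empty chain makes the leftmost
  -- point rightmost, 1 + 1 makes one edge both upper and lower, sums 3 and 4 are the triangle and
  -- the quadrilateral, and the rest have at least five edges. For 2 + 2 the opposite corners are
  -- the two ends of the chains, for 1 + 3 the left end and the second next corner of the long
  -- chain.
  no-hull : ∀ {l} → Up.Leftmost l → Up.Chain l → ¬ Down.Chain l
  no-hull min (HullChain.end max) _ = not-both-ends min max
  no-hull min (HullChain.step _ _) (HullChain.end max) = not-both-ends min max
  no-hull min (HullChain.step lq (HullChain.end max)) (HullChain.step lq′ (HullChain.end max′))
    with refl ← rightmost-unique max max′ = upper-lower-disjoint lq lq′
  no-hull min up@(HullChain.step lr (HullChain.end max))
    down@(HullChain.step lt (HullChain.step tr (HullChain.end max′)))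
    with refl ← rightmost-unique max max′ =
    triangle min up down refl (lower-supports lt) (lower-supports tr) (upper-supports lr)
      ((inj₁ refl , inj₂ (inj₂ refl)) ∷ (inj₁ refl , inj₂ (inj₁ refl)) ∷
       (inj₂ (inj₁ refl) , inj₂ (inj₂ refl)) ∷ [])
  no-hull min up@(HullChain.step lt (HullChain.step tr (HullChain.end max)))
    down@(HullChain.step lr (HullChain.end max′))
    with refl ← rightmost-unique max max′ =
    triangle min up down refl (lower-supports lr) (upper-supports tr) (upper-supports lt)
      ((inj₁ refl , inj₂ (inj₂ refl)) ∷ (inj₂ (inj₂ refl) , inj₂ (inj₁ refl)) ∷
       (inj₁ refl , inj₂ (inj₁ refl)) ∷ [])
  no-hull min up@(HullChain.step lt (HullChain.step tr (HullChain.end max)))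
    down@(HullChain.step ls (HullChain.step sr (HullChain.end max′)))
    with refl ← rightmost-unique max max′ =
    Shape.Quadrilateral.impossible min up down refl (≺⇒≢ (≺-trans (proj₁ lt) (proj₁ tr)))
      (inj₁ (inj₁ refl) ∷ inj₂ (inj₂ refl) ∷ inj₁ (inj₁ refl) ∷ inj₂ (inj₂ refl) ∷ [])
  no-hull min up@(HullChain.step lr (HullChain.end _))
    down@(HullChain.step ls (HullChain.step st (HullChain.step tr (HullChain.end _)))) =
    Shape.Quadrilateral.impossible min up down refl (≺⇒≢ (≺-trans (proj₁ ls) (proj₁ st)))
      (inj₁ (inj₁ refl) ∷ inj₁ (inj₁ refl) ∷ inj₂ (inj₂ refl) ∷ inj₂ (inj₁ refl) ∷ [])
  no-hull min up@(HullChain.step ls (HullChain.step st (HullChain.step tr (HullChain.end _))))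
    down@(HullChain.step lr (HullChain.end _)) =
    Shape.Quadrilateral.impossible min up down refl (≺⇒≢ (≺-trans (proj₁ ls) (proj₁ st)))
      (inj₁ (inj₁ refl) ∷ inj₂ (inj₂ refl) ∷ inj₂ (inj₁ refl) ∷ inj₁ (inj₁ refl) ∷ [])
  no-hull min up@(HullChain.step _ (HullChain.end _))
    down@(HullChain.step _ (HullChain.step _ (HullChain.step _ (HullChain.step _ _)))) =
    Shape.hull-≤4 min up down (ℕ.m≤m+n 5 _)
  no-hull min up@(HullChain.step _ (HullChain.step _ (HullChain.end _)))
    down@(HullChain.step _ (HullChain.step _ (HullChain.step _ _))) =
    Shape.hull-≤4 min up down (ℕ.m≤m+n 5 _)
  no-hull min up@(HullChain.step _ (HullChain.step _ (HullChain.step _ (HullChain.end _))))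
    down@(HullChain.step _ (HullChain.step _ _)) =
    Shape.hull-≤4 min up down (ℕ.m≤m+n 5 _)
  no-hull min up@(HullChain.step _ (HullChain.step _ (HullChain.step _ (HullChain.step _ c))))
    down@(HullChain.step _ _) =
    Shape.hull-≤4 min up down (ℕ.+-monoʳ-≤ 4 (ℕ.≤-trans (ℕ.s≤s ℕ.z≤n) (ℕ.m≤n+m _ (length (Up.chainEdges c)))))

  impossible : ⊥
  impossible = let l , min = Up.leftmost 0F in
    no-hull min (Up.chain l (inj₁ min)) (Down.chain l (inj₁ min))

-- Perturbation into general position

-- "For all sufficiently small positive ε". Finite conjunctions preserve it, so one ε meets all
-- requirements on the perturbed points at once.
Eventually : (ℚ → Set) → Set
Eventually P = ∃ λ ε₀ → 0ℚ < ε₀ × (∀ ε → 0ℚ < ε → ε < ε₀ → P ε)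

ev-map : ∀ {P Q : ℚ → Set} → (∀ ε → 0ℚ < ε → P ε → Q ε) → Eventually P → Eventually Q
ev-map f (ε₀ , 0<ε₀ , p) = ε₀ , 0<ε₀ , λ ε 0<ε ε<ε₀ → f ε 0<ε (p ε 0<ε ε<ε₀)

ev-always : ∀ {P : ℚ → Set} → (∀ ε → 0ℚ < ε → P ε) → Eventually P
ev-always p = 1ℚ , ℚ.positive⁻¹ 1ℚ , λ ε 0<ε _ → p ε 0<ε

ev-× : ∀ {P Q : ℚ → Set} → Eventually P → Eventually Q → Eventually (λ ε → P ε × Q ε)
ev-× (ε₁ , 0<ε₁ , p) (ε₂ , 0<ε₂ , q) = ε₁ ⊓ ε₂ , 0<⊓ , λ ε 0<ε ε<⊓ →
  p ε 0<ε (ℚ.<-≤-trans ε<⊓ (ℚ.p⊓q≤p ε₁ ε₂)) , q ε 0<ε (ℚ.<-≤-trans ε<⊓ (ℚ.p⊓q≤q ε₁ ε₂))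
  where
  0<⊓ : 0ℚ < ε₁ ⊓ ε₂
  0<⊓ with ℚ.⊓-sel ε₁ ε₂
  ... | inj₁ eq = subst (0ℚ <_) (sym eq) 0<ε₁
  ... | inj₂ eq = subst (0ℚ <_) (sym eq) 0<ε₂

ev-all : ∀ {n} {P : Fin n → ℚ → Set} → (∀ i → Eventually (P i)) → Eventually (λ ε → ∀ i → P i ε)
ev-all {zero} p = ev-always λ ε _ ()
ev-all {suc n} p = ev-map (λ { ε _ (p₀ , ps) zero → p₀ ; ε _ (p₀ , ps) (suc i) → ps i })
  (ev-× (p zero) (ev-all (p ∘ suc)))

ev-→ : ∀ {A : Set} {P : ℚ → Set} → Dec A → (A → Eventually P) → Eventually (λ ε → A → P ε)
ev-→ (yes a) p = ev-map (λ _ _ pε _ → pε) (p a)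
ev-→ (no ¬a) p = ev-always λ _ _ a → contradiction a ¬a

inverse : ∀ {p} → 0ℚ < p → ∃ λ q → 0ℚ < q × q * p ≡ 1ℚ
inverse {p} 0<p = 1/ p , ℚ.positive⁻¹ (1/ p) {{ℚ.1/pos⇒pos p}} , ℚ.*-inverseˡ p
  where instance
    p-pos = positive 0<p
    p-nonzero : NonZero p
    p-nonzero = ℚ.pos⇒nonZero p

ev-linear : ∀ {a} b → 0ℚ < a → Eventually (λ ε → 0ℚ < a + ε * b)
ev-linear {a} b 0<a with b ℚ.<? 0ℚ
... | no b≮0 = ev-always λ ε 0<ε → ℚ.+-mono-<-≤ 0<a (*-nonneg (ℚ.<⇒≤ 0<ε) (ℚ.≮⇒≥ b≮0))
... | yes b<0 = let q , 0<q , q*-b≡1 = inverse (neg⇒0<- b<0) in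
  -- The threshold is the zero a / (- b) of the linear function.
  a * q , *-pos 0<a 0<q , λ ε 0<ε ε<aq →
    subst (0ℚ <_)
      (trans (solve 4 (λ a q b ε → (a :* q :- ε) :* (:- b) := a :* (q :* (:- b)) :+ ε :* b) refl a q b ε)
        (cong (_+ ε * b) (trans (cong (a *_) q*-b≡1) (ℚ.*-identityʳ a))))
      (*-pos (<⇒0<- ε<aq) (neg⇒0<- b<0))

ev-quadratic : ∀ {a} b c → 0ℚ < a → Eventually (λ ε → 0ℚ < a + ε * (b + ε * c))
ev-quadratic {a} b c 0<a = ev-map
  (λ ε 0<ε (p , q) → subst (0ℚ <_)
    -- One unit of the linear coefficient is set aside to dominate ε * c, which leaves two linear
    -- conditions.
    (solve 4 (λ a b c ε → (a :+ ε :* (b :- con 1ℚ)) :+ ε :* (con 1ℚ :+ ε :* c) := a :+ ε :* (b :+ ε :* c)) refl a b c ε)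
    (+-pos p (*-pos 0<ε q)))
  (ev-× (ev-linear (b - 1ℚ) 0<a) (ev-linear c (ℚ.positive⁻¹ 1ℚ)))

neg-≢0 : ∀ {p q} → - p ≡ q → 0ℚ < q → p ≢ 0ℚ
neg-≢0 refl 0<-p refl = ℚ.<-irrefl refl 0<-p

-- Near zero the sign of the polynomial is that of its lowest nonzero coefficient.
ev-nonzero : ∀ a b c → a ≢ 0ℚ ⊎ b ≢ 0ℚ ⊎ c ≢ 0ℚ → Eventually (λ ε → a + ε * (b + ε * c) ≢ 0ℚ)
ev-nonzero a b c nz with a ℚ.≟ 0ℚ
... | no a≢0 with sign a≢0
...   | inj₁ 0<a = ev-map (λ ε _ p eq → ℚ.<-irrefl (sym eq) p) (ev-quadratic b c 0<a)
...   | inj₂ a<0 = ev-map (λ ε _ → neg-≢0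
        (solve 4 (λ a b c ε → :- (a :+ ε :* (b :+ ε :* c)) := (:- a) :+ ε :* ((:- b) :+ ε :* (:- c))) refl a b c ε))
        (ev-quadratic (- b) (- c) a<0)
ev-nonzero a b c nz | yes refl with b ℚ.≟ 0ℚ
... | no b≢0 with sign b≢0
...   | inj₁ 0<b = ev-map (λ ε 0<ε p eq → ℚ.<-irrefl (trans (sym eq) (ℚ.+-identityˡ (ε * (b + ε * c)))) (*-pos 0<ε p))
        (ev-linear c 0<b)
...   | inj₂ b<0 = ev-map (λ ε 0<ε p → neg-≢0
        (solve 3 (λ b c ε → :- (con 0ℚ :+ ε :* (b :+ ε :* c)) := ε :* ((:- b) :+ ε :* (:- c))) refl b c ε) (*-pos 0<ε p))
        (ev-linear (- c) b<0)
ev-nonzero a b c nz | yes refl | yes refl with nz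
... | inj₁ a≢0 = contradiction refl a≢0
... | inj₂ (inj₁ b≢0) = contradiction refl b≢0
... | inj₂ (inj₂ c≢0) = ev-always λ ε 0<ε eq → *-≢0 (ε≢0 0<ε) (*-≢0 (ε≢0 0<ε) c≢0) (trans (sym (begin
    0ℚ + ε * (0ℚ + ε * c)  ≡⟨ solve 2 (λ c ε → con 0ℚ :+ ε :* (con 0ℚ :+ ε :* c) := ε :* (ε :* c)) refl c ε ⟩
    ε * (ε * c) ∎)) eq)
  where
  open ≡-Reasoning
  ε≢0 : ∀ {ε} → 0ℚ < ε → ε ≢ 0ℚ
  ε≢0 0<ε refl = ℚ.<-irrefl refl 0<ε

move : Point → Point → ℚ → Point
move (px , py) (vx , vy) ε = px + ε * vx , py + ε * vy

opaque
  unfolding det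

  -- The polar form of `det`, a quadratic form in the triple of points.
  mixed : (a u b v c w : Point) → ℚ
  mixed (ax , ay) (ux , uy) (bx , by) (vx , vy) (cx , cy) (wx , wy) =
    (bx - ax) * (wy - uy) + (vx - ux) * (cy - ay) - ((by - ay) * (wx - ux) + (vy - uy) * (cx - ax))

  det-move : ∀ a u b v c w ε → det (move a u ε) (move b v ε) (move c w ε) ≡
             det a b c + ε * (mixed a u b v c w + ε * det u v w)
  det-move (ax , ay) (ux , uy) (bx , by) (vx , vy) (cx , cy) (wx , wy) =
    solve 13 (λ ax ay ux uy bx by vx vy cx cy wx wy ε →
      ((bx :+ ε :* vx) :- (ax :+ ε :* ux)) :* ((cy :+ ε :* wy) :- (ay :+ ε :* uy)) :-
      ((by :+ ε :* vy) :- (ay :+ ε :* uy)) :* ((cx :+ ε :* wx) :- (ax :+ ε :* ux)) :=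
      ((bx :- ax) :* (cy :- ay) :- (by :- ay) :* (cx :- ax)) :+ ε :*
      (((bx :- ax) :* (wy :- uy) :+ (vx :- ux) :* (cy :- ay) :- ((by :- ay) :* (wx :- ux) :+ (vy :- uy) :* (cx :- ax)))
       :+ ε :* ((vx :- ux) :* (wy :- uy) :- (vy :- uy) :* (wx :- ux))))
      refl ax ay ux uy bx by vx vy cx cy wx wy

  -- Both sides are the cross product of b - a and d - c, which vanishes exactly for parallel
  -- directions.
  det-difference : ∀ a b c d → det c d a - det c d b ≡ det a b d - det a b c
  det-difference (ax , ay) (bx , by) (cx , cy) (dx , dy) = solve 8 (λ ax ay bx by cx cy dx dy →
    ((dx :- cx) :* (ay :- cy) :- (dy :- cy) :* (ax :- cx)) :- ((dx :- cx) :* (by :- cy) :- (dy :- cy) :* (bx :- cx)) :=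
    ((bx :- ax) :* (dy :- ay) :- (by :- ay) :* (dx :- ax)) :- ((bx :- ax) :* (cy :- ay) :- (by :- ay) :* (cx :- ax)))
    refl ax ay bx by cx cy dx dy

  -- Cramer's rule cleared of its denominator W = det a b d - det a b c: the lines meet at a + (det
  -- c d a / W)(b - a) = c - (det a b c / W)(d - c).
  balance-x : ∀ a b c d → (det a b d - det a b c) * (proj₁ a - proj₁ c) + det c d a * (proj₁ b - proj₁ a)
              + det a b c * (proj₁ d - proj₁ c) ≡ 0ℚ
  balance-x (ax , ay) (bx , by) (cx , cy) (dx , dy) = solve 8 (λ ax ay bx by cx cy dx dy →
    (((bx :- ax) :* (dy :- ay) :- (by :- ay) :* (dx :- ax)) :- ((bx :- ax) :* (cy :- ay) :- (by :- ay) :* (cx :- ax))) :* (ax :- cx)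
    :+ ((dx :- cx) :* (ay :- cy) :- (dy :- cy) :* (ax :- cx)) :* (bx :- ax)
    :+ ((bx :- ax) :* (cy :- ay) :- (by :- ay) :* (cx :- ax)) :* (dx :- cx) := con 0ℚ)
    refl ax ay bx by cx cy dx dy

  balance-y : ∀ a b c d → (det a b d - det a b c) * (proj₂ a - proj₂ c) + det c d a * (proj₂ b - proj₂ a)
              + det a b c * (proj₂ d - proj₂ c) ≡ 0ℚ
  balance-y (ax , ay) (bx , by) (cx , cy) (dx , dy) = solve 8 (λ ax ay bx by cx cy dx dy →
    (((bx :- ax) :* (dy :- ay) :- (by :- ay) :* (dx :- ax)) :- ((bx :- ax) :* (cy :- ay) :- (by :- ay) :* (cx :- ax))) :* (ay :- cy)
    :+ ((dx :- cx) :* (ay :- cy) :- (dy :- cy) :* (ax :- cx)) :* (by :- ay)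
    :+ ((bx :- ax) :* (cy :- ay) :- (by :- ay) :* (cx :- ax)) :* (dy :- cy) := con 0ℚ)
    refl ax ay bx by cx cy dx dy

  collinear-y : ∀ a b p q → q * (proj₁ b - proj₁ a) ≡ 1ℚ → det a b p ≡ 0ℚ →
                proj₂ p ≡ proj₂ a + (proj₁ p - proj₁ a) * q * (proj₂ b - proj₂ a)
  collinear-y (ax , ay) (bx , by) (px , py) q q≡1 det≡0 = -≡0⇒≡ (trans
    (solve 7 (λ ax ay bx by px py q → py :- (ay :+ (px :- ax) :* q :* (by :- ay)) :=
      (py :- ay) :* (con 1ℚ :- q :* (bx :- ax)) :+ q :* ((bx :- ax) :* (py :- ay) :- (by :- ay) :* (px :- ax)))
      refl ax ay bx by px py q)
    (trans (cong₂ (λ e f → (py - ay) * (1ℚ - e) + q * f) q≡1 det≡0)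
      (solve 2 (λ q r → r :* (con 1ℚ :- con 1ℚ) :+ q :* con 0ℚ := con 0ℚ) refl q (py - ay))))

  vertical-collinear : ∀ a b c d → det a b c ≡ 0ℚ → det a b d ≡ 0ℚ → proj₁ c ≡ proj₁ d →
                       (proj₁ b - proj₁ a) * (proj₂ d - proj₂ c) ≡ 0ℚ
  vertical-collinear (ax , ay) (bx , by) (cx , cy) (_ , dy) abc abd refl = trans
    (solve 7 (λ ax ay bx by cx cy dy → (bx :- ax) :* (dy :- cy) :=
      ((bx :- ax) :* (dy :- ay) :- (by :- ay) :* (cx :- ax)) :- ((bx :- ax) :* (cy :- ay) :- (by :- ay) :* (cx :- ax)))
      refl ax ay bx by cx cy dy)
    (cong₂ _-_ abd abc)

  det-transpose : ∀ a b c → det (proj₂ a , proj₁ a) (proj₂ b , proj₁ b) (proj₂ c , proj₁ c) ≡ - det a b c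
  det-transpose (ax , ay) (bx , by) (cx , cy) = solve 6 (λ ax ay bx by cx cy →
    (by :- ay) :* (cx :- ax) :- (bx :- ax) :* (cy :- ay) := :- ((bx :- ax) :* (cy :- ay) :- (by :- ay) :* (cx :- ax)))
    refl ax ay bx by cx cy

-- Disjoint segments under small motions

Disjoint : (a b c d : Point) → Set
Disjoint a b c d = ∀ p → OnSegment a b p → ¬ OnSegment c d p

on-start : ∀ a b → OnSegment a b a
on-start (ax , ay) (bx , by) = 0ℚ , ℚ.≤-refl , ℚ.<⇒≤ (ℚ.positive⁻¹ 1ℚ) , at-zero ax bx , at-zero ay by
  where
  at-zero : ∀ p q → p ≡ p + 0ℚ * (q - p)
  at-zero = solve 2 (λ p q → p := p :+ con 0ℚ :* (q :- p)) refl

on-swap : ∀ a b {p} → OnSegment a b p → OnSegment b a p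
on-swap (ax , ay) (bx , by) (t , 0≤t , t≤1 , px , py) =
  1ℚ - t , ≤⇒0≤- t≤1 ,
  subst (1ℚ - t ≤_) (ℚ.+-identityʳ 1ℚ) (ℚ.+-monoʳ-≤ 1ℚ (ℚ.neg-antimono-≤ 0≤t)) ,
  trans px (reverse ax bx t) , trans py (reverse ay by t)
  where
  reverse : ∀ a b t → a + t * (b - a) ≡ b + (1ℚ - t) * (a - b)
  reverse = solve 3 (λ a b t → a :+ t :* (b :- a) := b :+ (con 1ℚ :- t) :* (a :- b)) refl

Disjoint-sym : ∀ {a b c d} → Disjoint a b c d → Disjoint c d a b
Disjoint-sym dis p cd ab = dis p ab cd

Disjoint-swapˡ : ∀ {a b c d} → Disjoint a b c d → Disjoint b a c d
Disjoint-swapˡ {a} {b} dis p ba cd = dis p (on-swap b a ba) cd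

Disjoint-swapʳ : ∀ {a b c d} → Disjoint a b c d → Disjoint a b d c
Disjoint-swapʳ {c = c} {d} dis p ab dc = dis p ab (on-swap d c dc)

-- The lines are not parallel, and the sign conditions place both parameters of their common point
-- between 0 and 1; `det-difference` gives the upper bound on a b.
intersect : ∀ {a b c d} → det a b c ≤ 0ℚ → 0ℚ ≤ det a b d → det c d b ≤ 0ℚ → 0ℚ ≤ det c d a →
            det a b c ≢ det a b d → ¬ Disjoint a b c d
intersect {a} {b} {c} {d} abc abd cdb cda abc≢abd disjoint =
  disjoint (proj₁ a + det c d a * q * (proj₁ b - proj₁ a) , proj₂ a + det c d a * q * (proj₂ b - proj₂ a))
    (det c d a * q , *-nonneg cda (ℚ.<⇒≤ 0<q) , below-one cda≤W , refl , refl)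
    (- det a b c * q , *-nonneg (ℚ.neg-antimono-≤ abc) (ℚ.<⇒≤ 0<q) , below-one -abc≤W ,
      meet (proj₁ a) (proj₁ b) (proj₁ c) (proj₁ d) (balance-x a b c d) ,
      meet (proj₂ a) (proj₂ b) (proj₂ c) (proj₂ d) (balance-y a b c d))
  where
  W = det a b d - det a b c
  0<W : 0ℚ < W
  0<W = <⇒0<- (ℚ.≰⇒> λ abd≤abc → abc≢abd (ℚ.≤-antisym (ℚ.≤-trans abc abd) abd≤abc))
  q = proj₁ (inverse 0<W)
  0<q = proj₁ (proj₂ (inverse 0<W))
  qW≡1 = proj₂ (proj₂ (inverse 0<W))
  below-one : ∀ {p} → p ≤ W → p * q ≤ 1ℚ
  below-one {p} p≤W = subst (p * q ≤_) (trans (ℚ.*-comm W q) qW≡1)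
    (ℚ.*-monoʳ-≤-nonNeg q {{nonNegative (ℚ.<⇒≤ 0<q)}} p≤W)
  cda≤W : det c d a ≤ W
  cda≤W = subst₂ _≤_ (ℚ.+-identityʳ (det c d a)) (det-difference a b c d)
    (ℚ.+-monoʳ-≤ (det c d a) (ℚ.neg-antimono-≤ cdb))
  -abc≤W : - det a b c ≤ W
  -abc≤W = subst (_≤ W) (ℚ.+-identityˡ (- det a b c)) (ℚ.+-monoˡ-≤ (- det a b c) abd)
  meet : ∀ k l m n → W * (k - m) + det c d a * (l - k) + det a b c * (n - m) ≡ 0ℚ →
         k + det c d a * q * (l - k) ≡ m + - det a b c * q * (n - m)
  meet k l m n eq = -≡0⇒≡ (trans
    (solve 8 (λ k l m n q W C A → (k :+ C :* q :* (l :- k)) :- (m :+ (:- A) :* q :* (n :- m)) :=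
      (k :- m) :* (con 1ℚ :- q :* W) :+ q :* (W :* (k :- m) :+ C :* (l :- k) :+ A :* (n :- m)))
      refl k l m n q W (det c d a) (det a b c))
    (trans (cong₂ (λ e f → (k - m) * (1ℚ - e) + q * f) qW≡1 eq)
      (solve 2 (λ q r → r :* (con 1ℚ :- con 1ℚ) :+ q :* con 0ℚ := con 0ℚ) refl q (k - m))))

between : ∀ {a b p} → proj₁ a < proj₁ b → det a b p ≡ 0ℚ → proj₁ a ≤ proj₁ p → proj₁ p ≤ proj₁ b → OnSegment a b p
between {a} {b} {p} a<b abp a≤p p≤b =
  (proj₁ p - proj₁ a) * q , *-nonneg (≤⇒0≤- a≤p) (ℚ.<⇒≤ 0<q) ,
  subst ((proj₁ p - proj₁ a) * q ≤_) (trans (ℚ.*-comm _ q) q≡1)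
    (ℚ.*-monoʳ-≤-nonNeg q {{nonNegative (ℚ.<⇒≤ 0<q)}} (ℚ.+-monoˡ-≤ (- proj₁ a) p≤b)) ,
  -≡0⇒≡ (trans
    (solve 4 (λ a b p q → p :- (a :+ (p :- a) :* q :* (b :- a)) := (p :- a) :* (con 1ℚ :- q :* (b :- a))) refl (proj₁ a) (proj₁ b) (proj₁ p) q)
    (trans (cong (λ e → (proj₁ p - proj₁ a) * (1ℚ - e)) q≡1) (ℚ.*-zeroʳ (proj₁ p - proj₁ a)))) ,
  collinear-y a b p q q≡1 abp
  where
  q = proj₁ (inverse (<⇒0<- a<b))
  0<q = proj₁ (proj₂ (inverse (<⇒0<- a<b)))
  q≡1 = proj₂ (proj₂ (inverse (<⇒0<- a<b)))

collinear-separated : ∀ {a b c d} → proj₁ a < proj₁ b → proj₁ c < proj₁ d → det a b c ≡ 0ℚ → det c d a ≡ 0ℚ →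
                      Disjoint a b c d → proj₁ b < proj₁ c ⊎ proj₁ d < proj₁ a
collinear-separated {a} {b} {c} {d} a<b c<d abc cda disjoint with proj₁ b ℚ.<? proj₁ c | proj₁ d ℚ.<? proj₁ a
... | yes b<c | _ = inj₁ b<c
... | no _ | yes d<a = inj₂ d<a
... | no b≮c | no d≮a with proj₁ a ℚ.≤? proj₁ c
...   | yes a≤c = ⊥-elim (disjoint c (between {a} {b} a<b abc a≤c (ℚ.≮⇒≥ b≮c)) (on-start c d))
...   | no a≰c = ⊥-elim (disjoint a (on-start a b) (between {c} {d} c<d cda (ℚ.<⇒≤ (ℚ.≰⇒> a≰c)) (ℚ.≮⇒≥ d≮a)))

Stable : (a b c d : Point) → Set
Stable a b c d = ∀ u v w z → Eventually λ ε → ¬ Cross (move a u ε) (move b v ε) (move c w ε) (move d z ε)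

Stable-sym : ∀ {a b c d} → Stable a b c d → Stable c d a b
Stable-sym st u v w z = ev-map (λ _ _ ¬X → ¬X ∘ Cross-sym) (st w z u v)

Stable-swapˡ : ∀ {a b c d} → Stable a b c d → Stable b a c d
Stable-swapˡ st u v w z = ev-map (λ _ _ ¬X → ¬X ∘ Cross-swapˡ) (st v u w z)

Stable-swapʳ : ∀ {a b c d} → Stable a b c d → Stable a b d c
Stable-swapʳ st u v w z = ev-map (λ _ _ ¬X → ¬X ∘ Cross-swapʳ) (st u v z w)

ev-< : ∀ {p q} u v → p < q → Eventually (λ ε → p + ε * u < q + ε * v)
ev-< {p} {q} u v p<q = ev-map
  (λ ε _ pos → 0<-⇒< (subst (0ℚ <_)
    (solve 5 (λ p q u v ε → (q :- p) :+ ε :* (v :- u) := (q :+ ε :* v) :- (p :+ ε :* u)) refl p q u v ε) pos))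
  (ev-linear (v - u) (<⇒0<- p<q))

ordered-stable : ∀ {a b c d} → proj₁ a < proj₁ b → proj₁ b < proj₁ c → proj₁ c < proj₁ d → Stable a b c d
ordered-stable a<b b<c c<d u v w z = ev-map
  (λ ε _ (ab , bc , cd) X → separated-< x-affine (ℚ.<-trans bc cd) (ℚ.<⇒≤ bc) (ℚ.<⇒≤ ab) ℚ.≤-refl
    (Cross-sym (Cross-swapʳ X)))
  (ev-× (ev-< (proj₁ u) (proj₁ v) a<b) (ev-× (ev-< (proj₁ v) (proj₁ w) b<c) (ev-< (proj₁ w) (proj₁ z) c<d)))

ev-det : ∀ {a b c} u v w → 0ℚ < det a b c → Eventually (λ ε → 0ℚ < det (move a u ε) (move b v ε) (move c w ε))
ev-det {a} {b} {c} u v w 0<abc = ev-map (λ ε _ → subst (0ℚ <_) (sym (det-move a u b v c w ε)))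
  (ev-quadratic (mixed a u b v c w) (det u v w) 0<abc)

same-side-stable : ∀ {a b c d} → 0ℚ < det a b c → 0ℚ < det a b d → Stable a b c d
same-side-stable {a} {b} abc abd u v w z = ev-map
  (λ ε _ (abc , abd) X → separated-< (det-affine (move a u ε) (move b v ε)) abc (ℚ.<⇒≤ abd)
    (ℚ.≤-reflexive (det-left (move a u ε) (move b v ε))) (ℚ.≤-reflexive (det-right (move a u ε) (move b v ε)))
    (Cross-sym X))
  (ev-× (ev-det u v w abc) (ev-det u v z abd))

det-swap-≡0 : ∀ {a b c} → det a b c ≡ 0ℚ → det b a c ≡ 0ℚ
det-swap-≡0 {a} {b} {c} abc = trans (det-swap a b c) (cong -_ abc)

sorted-stable : ∀ {a b c d} → proj₁ a < proj₁ b → proj₁ c < proj₁ d → det a b c ≡ 0ℚ → det c d a ≡ 0ℚ →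
                Disjoint a b c d → Stable a b c d
sorted-stable {a} {b} {c} {d} a<b c<d abc cda disjoint =
  [ (λ b<c → ordered-stable {a} {b} {c} {d} a<b b<c c<d)
  , (λ d<a → Stable-sym {c} {d} {a} {b} (ordered-stable {c} {d} {a} {b} c<d d<a a<b)) ]′
  (collinear-separated {a} {b} {c} {d} a<b c<d abc cda disjoint)

collinear-x-stable : ∀ {a b c d} → proj₁ a ≢ proj₁ b → c ≢ d →
  det a b c ≡ 0ℚ → det a b d ≡ 0ℚ → det c d a ≡ 0ℚ → det c d b ≡ 0ℚ → Disjoint a b c d → Stable a b c d
collinear-x-stable {a} {b} {c} {d} a≢b c≢d abc abd cda cdb disjoint =
  go (ℚ.<-cmp (proj₁ a) (proj₁ b)) (ℚ.<-cmp (proj₁ c) (proj₁ d))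
  where
  c≢d-x : proj₁ c ≢ proj₁ d
  c≢d-x eq = *-≢0 (λ b-a≡0 → a≢b (sym (-≡0⇒≡ b-a≡0)))
    (λ d-c≡0 → c≢d (cong₂ _,_ eq (sym (-≡0⇒≡ d-c≡0)))) (vertical-collinear a b c d abc abd eq)
  go : _ → _ → Stable a b c d
  go (tri≈ _ a≡b _) _ = contradiction a≡b a≢b
  go _ (tri≈ _ c≡d _) = contradiction c≡d c≢d-x
  go (tri< a<b _ _) (tri< c<d _ _) = sorted-stable {a} {b} {c} {d} a<b c<d abc cda disjoint
  go (tri< a<b _ _) (tri> _ _ d<c) = Stable-swapʳ {a} {b} {d} {c}
    (sorted-stable {a} {b} {d} {c} a<b d<c abd (det-swap-≡0 {c} {d} {a} cda)
      (Disjoint-swapʳ {a} {b} {c} {d} disjoint))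
  go (tri> _ _ b<a) (tri< c<d _ _) = Stable-swapˡ {b} {a} {c} {d}
    (sorted-stable {b} {a} {c} {d} b<a c<d (det-swap-≡0 {a} {b} {c} abc) cdb
      (Disjoint-swapˡ {a} {b} {c} {d} disjoint))
  go (tri> _ _ b<a) (tri> _ _ d<c) = Stable-swapˡ {b} {a} {c} {d} (Stable-swapʳ {b} {a} {d} {c}
    (sorted-stable {b} {a} {d} {c} b<a d<c (det-swap-≡0 {a} {b} {d} abd) (det-swap-≡0 {c} {d} {b} cdb)
      (Disjoint-swapˡ {a} {b} {d} {c} (Disjoint-swapʳ {a} {b} {c} {d} disjoint))))

transpose : Point → Point
transpose (x , y) = y , x

Cross-transpose : ∀ {a b c d} → Cross a b c d → Cross (transpose a) (transpose b) (transpose c) (transpose d)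
Cross-transpose X = record
  { 0<α = 0<α ; 0<β = 0<β ; 0<γ = 0<γ ; 0<δ = 0<δ ; weight = weight ; eqx = eqy ; eqy = eqx }
  where open Cross X

on-transpose : ∀ a b {p} → OnSegment (transpose a) (transpose b) p → OnSegment a b (transpose p)
on-transpose _ _ (t , 0≤t , t≤1 , px , py) = t , 0≤t , t≤1 , py , px

det-transpose-≡0 : ∀ a b c → det a b c ≡ 0ℚ → det (transpose a) (transpose b) (transpose c) ≡ 0ℚ
det-transpose-≡0 a b c abc = trans (det-transpose a b c) (cong -_ abc)

collinear-stable : ∀ {a b c d} → a ≢ b → c ≢ d →
  det a b c ≡ 0ℚ → det a b d ≡ 0ℚ → det c d a ≡ 0ℚ → det c d b ≡ 0ℚ → Disjoint a b c d → Stable a b c d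
collinear-stable {a} {b} {c} {d} a≢b c≢d abc abd cda cdb disjoint with proj₁ a ℚ.≟ proj₁ b
... | no a≢b-x = collinear-x-stable {a} {b} {c} {d} a≢b-x c≢d abc abd cda cdb disjoint
-- Segments on a vertical line cannot be told apart by abscissas; exchanging the coordinates makes
-- the line horizontal.
... | yes a≡b-x = λ u v w z → ev-map (λ _ _ ¬X → ¬X ∘ Cross-transpose)
  (collinear-x-stable {transpose a} {transpose b} {transpose c} {transpose d}
    (λ a≡b-y → a≢b (cong₂ _,_ a≡b-x a≡b-y)) (c≢d ∘ cong transpose)
    (det-transpose-≡0 a b c abc) (det-transpose-≡0 a b d abd) (det-transpose-≡0 c d a cda) (det-transpose-≡0 c d b cdb)
    (λ p ab cd → disjoint (transpose p) (on-transpose a b ab) (on-transpose c d cd))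
    (transpose u) (transpose v) (transpose w) (transpose z))

-- Strictly equal signs persist under small motions. All other combinations, including two zeros,
-- are weakly opposite, and then disjointness has to be used.
data Signs (p q : ℚ) : Set where
  both-pos : 0ℚ < p → 0ℚ < q → Signs p q
  both-neg : 0ℚ < - p → 0ℚ < - q → Signs p q
  rising   : p ≤ 0ℚ → 0ℚ ≤ q → Signs p q
  falling  : q ≤ 0ℚ → 0ℚ ≤ p → Signs p q

signs : ∀ p q → Signs p q
signs p q with ℚ.<-cmp 0ℚ p | ℚ.<-cmp 0ℚ q
... | tri< 0<p _ _ | tri< 0<q _ _ = both-pos 0<p 0<q
... | tri> _ _ p<0 | tri> _ _ q<0 = both-neg (neg⇒0<- p<0) (neg⇒0<- q<0)
... | tri< 0<p _ _ | tri≈ _ 0≡q _ = falling (ℚ.≤-reflexive (sym 0≡q)) (ℚ.<⇒≤ 0<p)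
... | tri< 0<p _ _ | tri> _ _ q<0 = falling (ℚ.<⇒≤ q<0) (ℚ.<⇒≤ 0<p)
... | tri≈ _ 0≡p _ | tri< 0<q _ _ = rising (ℚ.≤-reflexive (sym 0≡p)) (ℚ.<⇒≤ 0<q)
... | tri≈ _ 0≡p _ | tri≈ _ 0≡q _ = rising (ℚ.≤-reflexive (sym 0≡p)) (ℚ.≤-reflexive 0≡q)
... | tri≈ _ 0≡p _ | tri> _ _ q<0 = falling (ℚ.<⇒≤ q<0) (ℚ.≤-reflexive 0≡p)
... | tri> _ _ p<0 | tri< 0<q _ _ = rising (ℚ.<⇒≤ p<0) (ℚ.<⇒≤ 0<q)
... | tri> _ _ p<0 | tri≈ _ 0≡q _ = rising (ℚ.<⇒≤ p<0) (ℚ.≤-reflexive 0≡q)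

-- Disjointness leaves only parallel lines. Then the weak inequalities pinch all four determinants
-- to 0, and disjoint segments on one line are separated along it.
weakly-crossing-stable : ∀ {a b c d} → a ≢ b → c ≢ d →
  det a b c ≤ 0ℚ → 0ℚ ≤ det a b d → det c d b ≤ 0ℚ → 0ℚ ≤ det c d a → Disjoint a b c d → Stable a b c d
weakly-crossing-stable {a} {b} {c} {d} a≢b c≢d abc≤ abd≥ cdb≤ cda≥ disjoint with det a b c ℚ.≟ det a b d
... | no abc≢abd = ⊥-elim (intersect {a} {b} {c} {d} abc≤ abd≥ cdb≤ cda≥ abc≢abd disjoint)
... | yes abc≡abd = collinear-stable {a} {b} {c} {d} a≢b c≢d abc≡0 (trans (sym abc≡abd) abc≡0) cda≡0 (trans (sym cda≡cdb) cda≡0) disjoint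
  where
  cda≡cdb : det c d a ≡ det c d b
  cda≡cdb = -≡0⇒≡ (trans (det-difference a b c d) (≡⇒-≡0 (sym abc≡abd)))
  abc≡0 = ℚ.≤-antisym abc≤ (subst (0ℚ ≤_) (sym abc≡abd) abd≥)
  cda≡0 = ℚ.≤-antisym (subst (_≤ 0ℚ) (sym cda≡cdb) cdb≤) cda≥

rising-stable : ∀ {a b c d} → a ≢ b → c ≢ d → det a b c ≤ 0ℚ → 0ℚ ≤ det a b d → Disjoint a b c d → Stable a b c d
rising-stable {a} {b} {c} {d} a≢b c≢d abc≤ abd≥ disjoint with signs (det c d a) (det c d b)
... | both-pos cda cdb = Stable-sym {c} {d} {a} {b} (same-side-stable {c} {d} {a} {b} cda cdb)
... | both-neg cda cdb = Stable-sym {c} {d} {a} {b} (Stable-swapˡ {d} {c} {a} {b} (same-side-stable {d} {c} {a} {b}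
  (subst (0ℚ <_) (sym (det-swap c d a)) cda) (subst (0ℚ <_) (sym (det-swap c d b)) cdb)))
... | falling cdb≤ cda≥ = weakly-crossing-stable {a} {b} {c} {d} a≢b c≢d abc≤ abd≥ cdb≤ cda≥ disjoint
-- `det-difference` forces the opposite order of the two values, so both vanish and the falling
-- inequalities hold as well.
... | rising cda≤ cdb≥ = weakly-crossing-stable {a} {b} {c} {d} a≢b c≢d abc≤ abd≥
  (ℚ.≤-trans cdb≤cda cda≤) (ℚ.≤-trans cdb≥ cdb≤cda) disjoint
  where
  cdb≤cda : det c d b ≤ det c d a
  cdb≤cda = subst₂ _≤_ (ℚ.+-identityˡ (det c d b))
    (solve 2 (λ p q → (p :- q) :+ q := p) refl (det c d a) (det c d b))
    (ℚ.+-monoˡ-≤ (det c d b) (subst (0ℚ ≤_) (sym (det-difference a b c d)) (≤⇒0≤- (ℚ.≤-trans abc≤ abd≥))))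

disjoint-stable : ∀ {a b c d} → a ≢ b → c ≢ d → Disjoint a b c d → Stable a b c d
disjoint-stable {a} {b} {c} {d} a≢b c≢d disjoint with signs (det a b c) (det a b d)
... | both-pos abc abd = same-side-stable {a} {b} {c} {d} abc abd
... | both-neg abc abd = Stable-swapˡ {b} {a} {c} {d} (same-side-stable {b} {a} {c} {d}
  (subst (0ℚ <_) (sym (det-swap a b c)) abc) (subst (0ℚ <_) (sym (det-swap a b d)) abd))
... | rising abc≤ abd≥ = rising-stable {a} {b} {c} {d} a≢b c≢d abc≤ abd≥ disjoint
... | falling abd≤ abc≥ = Stable-swapʳ {a} {b} {d} {c} (rising-stable {a} {b} {d} {c} a≢b (c≢d ∘ sym) abd≤ abc≥
  (Disjoint-swapʳ {a} {b} {c} {d} disjoint))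

fromℕ : ℕ → ℚ
fromℕ zero = 0ℚ
fromℕ (suc n) = 1ℚ + fromℕ n

fromℕ-<-suc : ∀ n → fromℕ n < fromℕ (suc n)
fromℕ-<-suc n = subst (_< 1ℚ + fromℕ n) (ℚ.+-identityˡ (fromℕ n)) (ℚ.+-monoˡ-< (fromℕ n) (ℚ.positive⁻¹ 1ℚ))

fromℕ-mono-< : ∀ {m n} → m ℕ.<′ n → fromℕ m < fromℕ n
fromℕ-mono-< {m} ℕ.<′-base = fromℕ-<-suc m
fromℕ-mono-< {n = suc n} (ℕ.<′-step m<n) = ℚ.<-trans (fromℕ-mono-< m<n) (fromℕ-<-suc n)

fromℕ-injective : ∀ {m n} → fromℕ m ≡ fromℕ n → m ≡ n
fromℕ-injective {m} {n} eq with ℕ.<-cmp m n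
... | tri< m<n _ _ = contradiction (fromℕ-mono-< (ℕ.<⇒<′ m<n)) (ℚ.<-irrefl eq)
... | tri≈ _ m≡n _ = m≡n
... | tri> _ _ n<m = contradiction (fromℕ-mono-< (ℕ.<⇒<′ n<m)) (ℚ.<-irrefl (sym eq))

-- On a parabola, so that the ε²-coefficient of every moving determinant is a Vandermonde determinant.
velocity : ∀ {n} → Fin n → Point
velocity i = let t = fromℕ (Fin.toℕ i) in t , t * t

velocity-≢ : ∀ {n} {i j : Fin n} → i ≢ j → proj₁ (velocity i) - proj₁ (velocity j) ≢ 0ℚ
velocity-≢ i≢j eq = i≢j (Fin.toℕ-injective (fromℕ-injective (-≡0⇒≡ eq)))

opaque
  unfolding det

  det-vandermonde : ∀ r s t → det (r , r * r) (s , s * s) (t , t * t) ≡ (s - r) * ((t - r) * (t - s))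
  det-vandermonde = solve 3 (λ r s t →
    (s :- r) :* (t :* t :- r :* r) :- (s :* s :- r :* r) :* (t :- r) := (s :- r) :* ((t :- r) :* (t :- s))) refl

det-velocity-≢ : ∀ {n} {i j k : Fin n} → i ≢ j → j ≢ k → i ≢ k → det (velocity i) (velocity j) (velocity k) ≢ 0ℚ
det-velocity-≢ {i = i} {j} {k} i≢j j≢k i≢k eq =
  *-≢0 (velocity-≢ (i≢j ∘ sym)) (*-≢0 (velocity-≢ (i≢k ∘ sym)) (velocity-≢ (j≢k ∘ sym)))
    (trans (sym (det-vandermonde (proj₁ (velocity i)) (proj₁ (velocity j)) (proj₁ (velocity k)))) eq)

ev-witness : ∀ {P : ℚ → Set} → Eventually P → ∃ P
ev-witness (ε₀ , 0<ε₀ , p) = let ε , 0<ε , ε<ε₀ = ℚ.<-dense 0<ε₀ in ε , p ε 0<ε ε<ε₀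

module _ {n} (pos : Fin n → Point) where

  moved : ℚ → Fin n → Point
  moved ε i = move (pos i) (velocity i) ε

  XDistinct General : ℚ → Set
  XDistinct ε = ∀ i j → i ≢ j → proj₁ (moved ε i) - proj₁ (moved ε j) ≢ 0ℚ
  General ε = ∀ i j k → i ≢ j × j ≢ k × i ≢ k → det (moved ε i) (moved ε j) (moved ε k) ≢ 0ℚ

  ev-x-distinct : Eventually XDistinct
  ev-x-distinct = ev-all λ i → ev-all λ j → ev-→ (¬? (i Fin.≟ j)) λ i≢j →
    let x = proj₁ (pos i) ; y = proj₁ (pos j) ; s = proj₁ (velocity i) ; t = proj₁ (velocity j) in
    ev-map (λ ε _ → subst (_≢ 0ℚ)
      (solve 5 (λ x y s t ε → (x :- y) :+ ε :* ((s :- t) :+ ε :* con 0ℚ) := (x :+ ε :* s) :- (y :+ ε :* t)) refl x y s t ε))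
      (ev-nonzero (x - y) (s - t) 0ℚ (inj₂ (inj₁ (velocity-≢ i≢j))))

  ev-general : Eventually General
  ev-general = ev-all λ i → ev-all λ j → ev-all λ k →
    ev-→ (¬? (i Fin.≟ j) ×-dec ¬? (j Fin.≟ k) ×-dec ¬? (i Fin.≟ k)) λ (i≢j , j≢k , i≢k) →
    ev-map (λ ε _ → subst (_≢ 0ℚ) (sym (det-move (pos i) (velocity i) (pos j) (velocity j) (pos k) (velocity k) ε)))
      (ev-nonzero (det (pos i) (pos j) (pos k))
        (mixed (pos i) (velocity i) (pos j) (velocity j) (pos k) (velocity k)) (det (velocity i) (velocity j) (velocity k))
        (inj₂ (inj₂ (det-velocity-≢ i≢j j≢k i≢k))))

  configuration : ∀ ε → XDistinct ε → General ε → Configuration n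
  configuration ε xs gen = record
    { point = moved ε
    ; x-injective = λ {i} {j} eq → case i Fin.≟ j of λ where
        (yes i≡j) → i≡j
        (no i≢j) → contradiction (≡⇒-≡0 eq) (xs i j i≢j)
    ; general = λ {i} {j} {k} i≢j j≢k i≢k → gen i j k (i≢j , j≢k , i≢k) }

-- From a drawing to a symmetric layering in general position

module _ {k} (k≤3 : k ℕ.≤ 3) (D : GeometricDrawingKn 15 k) where
  open GeometricDrawingKn D

  -- Fewer layers are embedded into three, so one argument covers every k < 4. The value on the
  -- diagonal is arbitrary.
  layerOf : Fin 15 → Fin 15 → Fin 3
  layerOf i j with Fin.<-cmp i j
  ... | tri< i<j _ _ = inject≤ (layer i j i<j) k≤3
  ... | tri≈ _ _ _ = 0F
  ... | tri> _ _ j<i = inject≤ (layer j i j<i) k≤3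

  layerOf-< : ∀ {i j} (i<j : i Fin.< j) → layerOf i j ≡ inject≤ (layer i j i<j) k≤3
  layerOf-< {i} {j} i<j with Fin.<-cmp i j
  -- `layer` depends on the proof of i < j, so the two proofs have to be identified.
  ... | tri< i<j′ _ _ = cong (λ p → inject≤ (layer i j p) k≤3) (ℕ.≤-irrelevant i<j′ i<j)
  ... | tri≈ ≮ _ _ = contradiction i<j ≮
  ... | tri> ≮ _ _ = contradiction i<j ≮

  layerOf-> : ∀ {i j} (j<i : j Fin.< i) → layerOf i j ≡ inject≤ (layer j i j<i) k≤3
  layerOf-> {i} {j} j<i with Fin.<-cmp i j
  ... | tri< _ _ ≯ = contradiction j<i ≯
  ... | tri≈ _ _ ≯ = contradiction j<i ≯
  ... | tri> _ _ j<i′ = cong (λ p → inject≤ (layer j i p) k≤3) (ℕ.≤-irrelevant j<i′ j<i)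

  layerOf-sym : ∀ i j → layerOf i j ≡ layerOf j i
  layerOf-sym i j = case Fin.<-cmp i j of λ where
    (tri< i<j _ _) → trans (layerOf-< i<j) (sym (layerOf-> i<j))
    (tri≈ _ refl _) → refl
    (tri> _ _ j<i) → trans (layerOf-> j<i) (sym (layerOf-< j<i))

  SameLayer : (a b c d : Fin 15) → Set
  SameLayer a b c d = (a ≢ b × c ≢ d × c ≢ a × c ≢ b × d ≢ a × d ≢ b) × layerOf a b ≡ layerOf c d

  sameLayer? : ∀ a b c d → Dec (SameLayer a b c d)
  sameLayer? a b c d =
    (¬? (a Fin.≟ b) ×-dec ¬? (c Fin.≟ d) ×-dec ¬? (c Fin.≟ a) ×-dec ¬? (c Fin.≟ b) ×-dec
     ¬? (d Fin.≟ a) ×-dec ¬? (d Fin.≟ b)) ×-dec (layerOf a b Fin.≟ layerOf c d)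

  -- A common point would be an end of both edges, hence a shared vertex, since positions are
  -- distinct.
  disjoint-sorted : ∀ {a b c d} → a Fin.< b → c Fin.< d → SameLayer a b c d → Disjoint (pos a) (pos b) (pos c) (pos d)
  disjoint-sorted {a} {b} {c} {d} a<b c<d ((_ , _ , c≢a , c≢b , d≢a , d≢b) , same) p ab cd =
    case noCross a b c d a<b c<d (λ (a≡c , _) → c≢a (sym a≡c))
           (Fin.inject≤-injective k≤3 k≤3 _ _ (trans (sym (layerOf-< a<b)) (trans same (layerOf-< c<d)))) p ab cd of λ where
      (inj₁ pa , inj₁ pc) → c≢a (pos-inj (trans (sym pc) pa))
      (inj₁ pa , inj₂ pd) → d≢a (pos-inj (trans (sym pd) pa))
      (inj₂ pb , inj₁ pc) → c≢b (pos-inj (trans (sym pc) pb))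
      (inj₂ pb , inj₂ pd) → d≢b (pos-inj (trans (sym pd) pb))

  sameLayer-swapˡ : ∀ {a b c d} → SameLayer a b c d → SameLayer b a c d
  sameLayer-swapˡ {a} {b} ((a≢b , c≢d , c≢a , c≢b , d≢a , d≢b) , same) =
    (a≢b ∘ sym , c≢d , c≢b , c≢a , d≢b , d≢a) , trans (layerOf-sym b a) same

  sameLayer-swapʳ : ∀ {a b c d} → SameLayer a b c d → SameLayer a b d c
  sameLayer-swapʳ {c = c} {d} ((a≢b , c≢d , c≢a , c≢b , d≢a , d≢b) , same) =
    (a≢b , c≢d ∘ sym , d≢a , d≢b , c≢a , c≢b) , trans same (layerOf-sym c d)

  sameLayer-disjoint : ∀ {a b c d} → SameLayer a b c d → Disjoint (pos a) (pos b) (pos c) (pos d)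
  sameLayer-disjoint {a} {b} {c} {d} same@((a≢b , c≢d , _) , _) = go (Fin.<-cmp a b) (Fin.<-cmp c d)
    where
    go : _ → _ → Disjoint (pos a) (pos b) (pos c) (pos d)
    go (tri≈ _ a≡b _) _ = contradiction a≡b a≢b
    go _ (tri≈ _ c≡d _) = contradiction c≡d c≢d
    go (tri< a<b _ _) (tri< c<d _ _) = disjoint-sorted a<b c<d same
    go (tri< a<b _ _) (tri> _ _ d<c) = Disjoint-swapʳ {pos a} {pos b} {pos d} {pos c}
      (disjoint-sorted a<b d<c (sameLayer-swapʳ same))
    go (tri> _ _ b<a) (tri< c<d _ _) = Disjoint-swapˡ {pos b} {pos a} {pos c} {pos d}
      (disjoint-sorted b<a c<d (sameLayer-swapˡ same))
    go (tri> _ _ b<a) (tri> _ _ d<c) = Disjoint-swapˡ {pos b} {pos a} {pos c} {pos d}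
      (Disjoint-swapʳ {pos b} {pos a} {pos d} {pos c}
        (disjoint-sorted b<a d<c (sameLayer-swapˡ (sameLayer-swapʳ same))))

  Uncrossing : ℚ → Set
  Uncrossing ε = ∀ a b c d → SameLayer a b c d →
                 ¬ Cross (moved pos ε a) (moved pos ε b) (moved pos ε c) (moved pos ε d)

  ev-uncrossing : Eventually Uncrossing
  ev-uncrossing = ev-all λ a → ev-all λ b → ev-all λ c → ev-all λ d → ev-→ (sameLayer? a b c d)
    λ same@((a≢b , c≢d , _) , _) → disjoint-stable (a≢b ∘ pos-inj) (c≢d ∘ pos-inj) (sameLayer-disjoint same)
      (velocity a) (velocity b) (velocity c) (velocity d)

  no-drawing-in-≤3 : ⊥
  no-drawing-in-≤3 = go (ev-witness (ev-× (ev-x-distinct pos) (ev-× (ev-general pos) ev-uncrossing)))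
    where
    go : ∃ (λ ε → XDistinct pos ε × General pos ε × Uncrossing ε) → ⊥
    go (ε , xs , gen , unc) = LowerBound.impossible (configuration pos ε xs gen) layerOf layerOf-sym
      λ {a} {b} {c} {d} a≢b c≢d c≢a c≢b d≢a d≢b same → unc a b c d ((a≢b , c≢d , c≢a , c≢b , d≢a , d≢b) , same)

-- A drawing in four layers

-- Found by computer search.
coordinates : Vec (ℤ × ℤ) 15
coordinates =
  ((+ 197) , (+ 13)) ∷
  ((+ 106) , (+ 161)) ∷
  ((ℤ.- (+ 25)) , (+ 205)) ∷
  ((ℤ.- (+ 196)) , (+ 115)) ∷
  ((ℤ.- (+ 210)) , (+ 2)) ∷
  ((ℤ.- (+ 100)) , (ℤ.- (+ 185))) ∷
  ((+ 43) , (ℤ.- (+ 217))) ∷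
  ((+ 175) , (ℤ.- (+ 171))) ∷
  ((+ 2290) , (+ 2713)) ∷
  ((+ 250) , (+ 3734)) ∷
  ((ℤ.- (+ 3011)) , (+ 3038)) ∷
  ((ℤ.- (+ 4107)) , (ℤ.- (+ 68))) ∷
  ((ℤ.- (+ 3558)) , (ℤ.- (+ 2832))) ∷
  ((+ 147) , (ℤ.- (+ 3847))) ∷
  ((+ 3819) , (ℤ.- (+ 531))) ∷ []

-- Points 0 to 7 form a small convex octagon, and 8 to 14 lie far outside. Inside the octagon the
-- layer depends on i + j modulo 8, which yields four zigzag paths; the sides 0 7 and 6 7 are
-- exceptions. The edges from an outer point to the octagon lie mostly in one layer, except at point
-- 14, where they are split between two.
layers : Vec (Vec (Fin 4) 15) 15
layers =
  (0F ∷ 3F ∷ 3F ∷ 1F ∷ 1F ∷ 2F ∷ 2F ∷ 3F ∷ 2F ∷ 0F ∷ 3F ∷ 1F ∷ 2F ∷ 0F ∷ 3F ∷ []) ∷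
  (3F ∷ 0F ∷ 1F ∷ 1F ∷ 2F ∷ 2F ∷ 0F ∷ 0F ∷ 2F ∷ 0F ∷ 3F ∷ 1F ∷ 2F ∷ 0F ∷ 3F ∷ []) ∷
  (3F ∷ 1F ∷ 0F ∷ 2F ∷ 2F ∷ 0F ∷ 0F ∷ 3F ∷ 2F ∷ 0F ∷ 3F ∷ 1F ∷ 2F ∷ 0F ∷ 1F ∷ []) ∷
  (1F ∷ 1F ∷ 2F ∷ 0F ∷ 0F ∷ 0F ∷ 3F ∷ 3F ∷ 2F ∷ 0F ∷ 3F ∷ 1F ∷ 2F ∷ 0F ∷ 1F ∷ []) ∷
  (1F ∷ 2F ∷ 2F ∷ 0F ∷ 0F ∷ 3F ∷ 3F ∷ 1F ∷ 2F ∷ 0F ∷ 0F ∷ 1F ∷ 2F ∷ 0F ∷ 1F ∷ []) ∷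
  (2F ∷ 2F ∷ 0F ∷ 0F ∷ 3F ∷ 0F ∷ 1F ∷ 1F ∷ 2F ∷ 0F ∷ 3F ∷ 3F ∷ 2F ∷ 0F ∷ 1F ∷ []) ∷
  (2F ∷ 0F ∷ 0F ∷ 3F ∷ 3F ∷ 1F ∷ 0F ∷ 3F ∷ 2F ∷ 0F ∷ 3F ∷ 1F ∷ 2F ∷ 2F ∷ 1F ∷ []) ∷
  (3F ∷ 0F ∷ 3F ∷ 3F ∷ 1F ∷ 1F ∷ 3F ∷ 0F ∷ 2F ∷ 0F ∷ 3F ∷ 1F ∷ 3F ∷ 2F ∷ 3F ∷ []) ∷
  (2F ∷ 2F ∷ 2F ∷ 2F ∷ 2F ∷ 2F ∷ 2F ∷ 2F ∷ 0F ∷ 3F ∷ 1F ∷ 1F ∷ 2F ∷ 0F ∷ 1F ∷ []) ∷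
  (0F ∷ 0F ∷ 0F ∷ 0F ∷ 0F ∷ 0F ∷ 0F ∷ 0F ∷ 3F ∷ 0F ∷ 3F ∷ 2F ∷ 2F ∷ 0F ∷ 3F ∷ []) ∷
  (3F ∷ 3F ∷ 3F ∷ 3F ∷ 0F ∷ 3F ∷ 3F ∷ 3F ∷ 1F ∷ 3F ∷ 0F ∷ 3F ∷ 0F ∷ 0F ∷ 3F ∷ []) ∷
  (1F ∷ 1F ∷ 1F ∷ 1F ∷ 1F ∷ 3F ∷ 1F ∷ 1F ∷ 1F ∷ 2F ∷ 3F ∷ 0F ∷ 3F ∷ 1F ∷ 1F ∷ []) ∷
  (2F ∷ 2F ∷ 2F ∷ 2F ∷ 2F ∷ 2F ∷ 2F ∷ 3F ∷ 2F ∷ 2F ∷ 0F ∷ 3F ∷ 0F ∷ 1F ∷ 3F ∷ []) ∷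
  (0F ∷ 0F ∷ 0F ∷ 0F ∷ 0F ∷ 0F ∷ 2F ∷ 2F ∷ 0F ∷ 0F ∷ 0F ∷ 1F ∷ 1F ∷ 0F ∷ 0F ∷ []) ∷
  (3F ∷ 3F ∷ 1F ∷ 1F ∷ 1F ∷ 1F ∷ 1F ∷ 3F ∷ 1F ∷ 3F ∷ 3F ∷ 1F ∷ 3F ∷ 0F ∷ 0F ∷ []) ∷ []

position : Fin 15 → Point
position i = let x , y = Vec.lookup coordinates i in x / 1 , y / 1

layered : Fin 15 → Fin 15 → Fin 4
layered i j = Vec.lookup (Vec.lookup layers i) j

D : Fin 15 → Fin 15 → Fin 15 → ℚ
D i j k = det (position i) (position j) (position k)

-- A decidable certificate: one edge lies strictly on one side of the line through the other, or the
-- edges share an end and are not collinear.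
Clear : (i j k l : Fin 15) → Set
Clear i j k l =
  (0ℚ < D i j k × 0ℚ < D i j l) ⊎ (0ℚ < D j i k × 0ℚ < D j i l) ⊎
  (0ℚ < D k l i × 0ℚ < D k l j) ⊎ (0ℚ < D l k i × 0ℚ < D l k j) ⊎
  ((k ≡ i ⊎ k ≡ j) × D i j l ≢ 0ℚ) ⊎ ((l ≡ i ⊎ l ≡ j) × D i j k ≢ 0ℚ)

clear? : ∀ i j k l → Dec (Clear i j k l)
clear? i j k l =
  (0ℚ ℚ.<? _ ×-dec 0ℚ ℚ.<? _) ⊎-dec (0ℚ ℚ.<? _ ×-dec 0ℚ ℚ.<? _) ⊎-dec
  (0ℚ ℚ.<? _ ×-dec 0ℚ ℚ.<? _) ⊎-dec (0ℚ ℚ.<? _ ×-dec 0ℚ ℚ.<? _) ⊎-dec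
  ((k Fin.≟ i ⊎-dec k Fin.≟ j) ×-dec ¬? (D i j l ℚ.≟ 0ℚ)) ⊎-dec
  ((l Fin.≟ i ⊎-dec l Fin.≟ j) ×-dec ¬? (D i j k ℚ.≟ 0ℚ))

opaque
  unfolding det

  layers-clear : ∀ i j → i Fin.< j → ∀ k l → k Fin.< l → ¬ (i ≡ k × j ≡ l) →
                 layered i j ≡ layered k l → Clear i j k l
  -- The check over all pairs of edges is a computation, for which `det` has to be unfolded.
  layers-clear = toWitness {a? = Fin.all? λ i → Fin.all? λ j → (i Fin.<? j) →-dec Fin.all? λ k → Fin.all? λ l →
    (k Fin.<? l) →-dec ¬? (i Fin.≟ k ×-dec j Fin.≟ l) →-dec (layered i j Fin.≟ layered k l) →-dec clear? i j k l} _

  position-injective : ∀ i j → position i ≡ position j → i ≡ j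
  position-injective = toWitness {a? = Fin.all? λ i → Fin.all? λ j →
    ≡-dec ℚ._≟_ ℚ._≟_ (position i) (position j) →-dec (i Fin.≟ j)} _

  det-along : ∀ {a b c d p} → ((t , _) : OnSegment c d p) → det a b p ≡ (1ℚ - t) * det a b c + t * det a b d
  det-along {ax , ay} {bx , by} {cx , cy} {dx , dy} (t , _ , _ , refl , refl) = solve 9
    (λ ax ay bx by cx cy dx dy t →
      (bx :- ax) :* ((cy :+ t :* (dy :- cy)) :- ay) :- (by :- ay) :* ((cx :+ t :* (dx :- cx)) :- ax) :=
      (con 1ℚ :- t) :* ((bx :- ax) :* (cy :- ay) :- (by :- ay) :* (cx :- ax))
      :+ t :* ((bx :- ax) :* (dy :- ay) :- (by :- ay) :* (dx :- ax)))
    refl ax ay bx by cx cy dx dy t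

on-line : ∀ {a b p} → OnSegment a b p → det a b p ≡ 0ℚ
on-line {a} {b} s@(t , _) = trans (det-along {a} {b} {a} {b} s)
  (trans (cong₂ (λ e f → (1ℚ - t) * e + t * f) (det-left a b) (det-right a b))
    (solve 1 (λ t → (con 1ℚ :- t) :* con 0ℚ :+ t :* con 0ℚ := con 0ℚ) refl t))

same-side-disjoint : ∀ {a b c d} → 0ℚ < det a b c → 0ℚ < det a b d → Disjoint a b c d
same-side-disjoint {a} {b} {c} {d} abc abd p ab cd@(t , 0≤t , t≤1 , _) =
  ℚ.<-irrefl (trans (sym (on-line {a} {b} ab)) (det-along {a} {b} {c} {d} cd)) (positive-sum (ℚ.<-cmp 0ℚ t))
  where
  positive-sum : Tri (0ℚ < t) (0ℚ ≡ t) (t < 0ℚ) → 0ℚ < (1ℚ - t) * det a b c + t * det a b d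
  positive-sum (tri< 0<t _ _) = ℚ.+-mono-≤-< (*-nonneg (≤⇒0≤- t≤1) (ℚ.<⇒≤ abc)) (*-pos 0<t abd)
  positive-sum (tri≈ _ refl _) = subst (0ℚ <_)
    (solve 2 (λ x y → x := (con 1ℚ :- con 0ℚ) :* x :+ con 0ℚ :* y) refl (det a b c) (det a b d)) abc
  positive-sum (tri> _ _ t<0) = contradiction (ℚ.<-≤-trans t<0 0≤t) (ℚ.<-irrefl refl)

-- Along c d the height over a b is t times its value at d, which vanishes only at t = 0.
shared-start : ∀ {a b c d p} → det a b c ≡ 0ℚ → det a b d ≢ 0ℚ → OnSegment a b p → OnSegment c d p → p ≡ c
shared-start {a} {b} {c} {d} {p} abc abd≢0 ab cd@(t , _ , _ , px , py) with t ℚ.≟ 0ℚ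
... | no t≢0 = contradiction (begin
    t * det a b d                                ≡⟨ solve 2 (λ t y → t :* y := (con 1ℚ :- t) :* con 0ℚ :+ t :* y) refl t (det a b d) ⟩
    (1ℚ - t) * 0ℚ + t * det a b d                ≡⟨ cong (λ e → (1ℚ - t) * e + t * det a b d) (sym abc) ⟩
    (1ℚ - t) * det a b c + t * det a b d         ≡⟨ sym (det-along {a} {b} {c} {d} cd) ⟩
    det a b p                                    ≡⟨ on-line {a} {b} ab ⟩
    0ℚ                                           ∎) (*-≢0 t≢0 abd≢0)
  where open ≡-Reasoning
... | yes refl = cong₂ _,_ (trans px (at-zero (proj₁ c) (proj₁ d))) (trans py (at-zero (proj₂ c) (proj₂ d)))
  where
  at-zero : ∀ c d → c + 0ℚ * (d - c) ≡ c
  at-zero = solve 2 (λ c d → c :+ con 0ℚ :* (d :- c) := c) refl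

shared-noncrossing : ∀ {a b c d} → c ≡ a ⊎ c ≡ b → det a b d ≢ 0ℚ → NonCrossing a b c d
shared-noncrossing {a} {b} {c} {d} (inj₁ refl) abd p ab cd
  with p≡c ← shared-start {a} {b} {c} {d} (det-left a b) abd ab cd = inj₁ p≡c , inj₁ p≡c
shared-noncrossing {a} {b} {c} {d} (inj₂ refl) abd p ab cd
  with p≡c ← shared-start {a} {b} {c} {d} (det-right a b) abd ab cd = inj₂ p≡c , inj₁ p≡c

clear-noncrossing : ∀ i j k l → Clear i j k l → NonCrossing (position i) (position j) (position k) (position l)
clear-noncrossing i j k l = λ where
    (inj₁ (ijk , ijl)) → disjoint (same-side-disjoint {a} {b} {c} {d} ijk ijl)
    (inj₂ (inj₁ (jik , jil))) → disjoint (Disjoint-swapˡ {b} {a} {c} {d} (same-side-disjoint {b} {a} {c} {d} jik jil))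
    (inj₂ (inj₂ (inj₁ (kli , klj)))) → disjoint (Disjoint-sym {c} {d} {a} {b} (same-side-disjoint {c} {d} {a} {b} kli klj))
    (inj₂ (inj₂ (inj₂ (inj₁ (lki , lkj))))) → disjoint (Disjoint-sym {c} {d} {a} {b}
      (Disjoint-swapˡ {d} {c} {a} {b} (same-side-disjoint {d} {c} {a} {b} lki lkj)))
    (inj₂ (inj₂ (inj₂ (inj₂ (inj₁ (k∈ , ijl)))))) → shared-noncrossing {a} {b} {c} {d}
      ([ inj₁ ∘ cong position , inj₂ ∘ cong position ]′ k∈) ijl
    (inj₂ (inj₂ (inj₂ (inj₂ (inj₂ (l∈ , ijk)))))) p ab cd → Product.map₂ Sum.swap (shared-noncrossing {a} {b} {d} {c}
      ([ inj₁ ∘ cong position , inj₂ ∘ cong position ]′ l∈) ijk p ab (on-swap c d cd))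
  where
  a = position i
  b = position j
  c = position k
  d = position l
  disjoint : Disjoint a b c d → NonCrossing a b c d
  disjoint dis p ab cd = ⊥-elim (dis p ab cd)

drawing : GeometricDrawingKn 15 4
drawing = record
  { pos = position
  ; pos-inj = λ {i} {j} → position-injective i j
  ; layer = λ i j _ → layered i j
  ; noCross = λ i j k l i<j k<l distinct same → clear-noncrossing i j k l (layers-clear i j i<j k l k<l distinct same) }

theorem4p1 : GeometricThicknessKnIs 15 4
theorem4p1 = drawing , λ k k<4 → no-drawing-in-≤3 (ℕ.s≤s⁻¹ k<4)
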